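{- Let $\mathcal{I}=[-\tfrac12,\tfrac12]$ and let $\mathcal{B}$ be the family of all boxes contained in $\mathcal{I}^{2}$. In the range space $(\mathcal{I}^{2},\mathcal{B})$, for every $\epsilon>0$, there exists a deterministic construction of an $\epsilon$-net $\mathcal{N}_\epsilon$ with cardinality $\#\mathcal{N}_\epsilon=O\left(\epsilon^{ -1}\cdot\ln(\epsilon^{ -1})\right)$.
   Context: A range space is a pair $(\mathcal{S},\mathcal{R})$ where $\mathcal{S}$ is a set (whose members are called points) and $\mathcal{R}$ is a family of subsets of $\mathcal{S}$ (called ranges). A box in $\mathbb{R}^2$ is a rectangle of arbitrary orientation. Given $\epsilon>0$, a subset $\mathcal{N}_\epsilon\subseteq\mathcal{I}^{2}$ is an $\epsilon$-net in $(\mathcal{I}^2,\mathcal{B})$ if $\mathcal{N}_\epsilon$ intersects non-trivially (i.e. $\mathcal{N}_\epsilon\cap R\neq\emptyset$) every range $R\in\mathcal{B}$ with $\mu_2(R)\ge\epsilon$, where $\mu_2$ is the Lebesgue measure on $\mathcal{I}^2$. The notation $f(x)=O(g(x))$ denotes the existence of a constant $C>0$ such that $f(x)\le C\cdot g(x)$ for every $x$; here the variable is $\epsilon$ and $C$ does not depend on $\epsilon$. "Deterministic" means specified without any random choice.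
   Formalization: The bound on the cardinality is proved for 0 < ε ≤ ε₀ with a constant depending on ε₀, for each ε₀ < 1, since no constant serves all ε: ln(1/ε) is 0 at ε = 1, where the net needs a point, and negative for ε > 1. -}

module Defs where

open import Level using (0ℓ)
open import Data.Nat.Base as ℕ using (ℕ; zero; suc; _⊔_)
import Data.Nat.Properties as ℕₚ
import Data.Integer.Base as ℤ
import Data.Integer.Properties as ℤₚ
open import Data.Rational.Base as ℚ using (ℚ; 0ℚ; 1ℚ; ½)
import Data.Rational.Properties as ℚₚ
open import Data.Rational.Solver using (module +-*-Solver)
open import Algebra.Definitions.RawSemiring ℚₚ.+-*-rawSemiring using (_^_)
open import Data.List.Base using (List)
open import Data.List.Relation.Unary.All using (All)
open import Data.List.Relation.Unary.Any using (Any)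
open import Data.Product.Base using (Σ-syntax; ∃; ∃-syntax; _×_; _,_; proj₁; proj₂)
open import Data.Sum.Base using (inj₁; inj₂)
open import Relation.Binary.PropositionalEquality.Core using (_≡_; refl; sym; trans; cong; cong₂; subst; subst₂)
open import Relation.Unary using (Pred; _⊆_; _≐_)

IsCauchy : (ℕ → ℚ) → Set
IsCauchy x = ∀ δ → 0ℚ ℚ.< δ →
  ∃[ N ] (∀ m n → N ℕ.≤ m → N ℕ.≤ n → ℚ.∣ x m ℚ.- x n ∣ ℚ.≤ δ)

Eventually : Pred ℕ 0ℓ → Set
Eventually P = ∃[ N ] (∀ n → N ℕ.≤ n → P n)

-- Partial sums of artanh z = Σₖ z²ᵏ⁺¹ / (2k + 1).
artanhSum : ℕ → ℚ → ℚ
artanhSum zero    z = 0ℚ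
artanhSum (suc k) z =
  artanhSum k z ℚ.+ z ^ suc (2 ℕ.* k) ℚ.* (ℤ.+ 1 ℚ./ suc (2 ℕ.* k))

module CauchyLemmas where
  open import Data.Rational.Base using (_+_; _*_; _-_; -_; _≤_; _<_; ∣_∣; 1/_)
  open +-*-Solver using (solve; _:=_; _:+_; _:*_; _:-_; :-_; con)

  private
    neg-swap : ∀ a b → a - b ≡ - (b - a)
    neg-swap = solve 2 (λ a b → a :- b := :- (b :- a)) refl

    add-sub : ∀ a b → a + (b - a) ≡ b
    add-sub = solve 2 (λ a b → a :+ (b :- a) := b) refl

    swap-* : ∀ a b c → a * (b * c) ≡ b * (a * c)
    swap-* = solve 3 (λ a b c → a :* (b :* c) := b :* (a :* c)) refl

    recip-id : ∀ a b c d → (c * d) * (b - a) ≡ c * (b * d) - d * (a * c)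
    recip-id = solve 4 (λ a b c d → (c :* d) :* (b :- a) := c :* (b :* d) :- d :* (a :* c)) refl

    sum-diff : ∀ a b c d → (a - c) + (b - d) ≡ (a + b) - (c + d)
    sum-diff = solve 4 (λ a b c d → (a :- c) :+ (b :- d) := (a :+ b) :- (c :+ d)) refl

    double : ∀ d → d + d ≡ (1ℚ + 1ℚ) * d
    double = solve 1 (λ d → d :+ d := (con 1ℚ :+ con 1ℚ) :* d) refl

    neg-diff : ∀ a b → - (a - b) ≡ - a - - b
    neg-diff = solve 2 (λ a b → :- (a :- b) := :- a :- :- b) refl

    sub-add : ∀ a b → (a - b) + b ≡ a
    sub-add = solve 2 (λ a b → (a :- b) :+ b := a) refl

    prod-diff : ∀ a b c d → a * (b - d) + d * (a - c) ≡ a * b - c * d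
    prod-diff = solve 4 (λ a b c d → a :* (b :- d) :+ d :* (a :- c) := a :* b :- c :* d) refl

    chain : ∀ a b c d → (a - b) + (b - c) + (c - d) ≡ a - d
    chain = solve 4 (λ a b c d → (a :- b) :+ (b :- c) :+ (c :- d) := a :- d) refl

    triple : ∀ d → d + d + d ≡ (1ℚ + 1ℚ + 1ℚ) * d
    triple = solve 1 (λ d → d :+ d :+ d := (con 1ℚ :+ con 1ℚ :+ con 1ℚ) :* d) refl

    one-minus : ∀ c → c ≡ 1ℚ - (1ℚ - c)
    one-minus = solve 1 (λ c → c := con 1ℚ :- (con 1ℚ :- c)) refl

    bernoulli-base : ∀ c → 1ℚ * (1ℚ + 0ℚ * c) ≡ 1ℚ
    bernoulli-base = solve 1 (λ c → con 1ℚ :* (con 1ℚ :+ con 0ℚ :* c) := con 1ℚ) refl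

    bernoulli-id : ∀ c n r → r * ((1ℚ + n) * (c * c)) ≡
      r * (1ℚ + n * c) - ((1ℚ - c) * r) * (1ℚ + (1ℚ + n) * c)
    bernoulli-id = solve 3 (λ c n r → r :* ((con 1ℚ :+ n) :* (c :* c)) :=
      r :* (con 1ℚ :+ n :* c) :- ((con 1ℚ :- c) :* r) :* (con 1ℚ :+ (con 1ℚ :+ n) :* c)) refl

    small-id : ∀ c e n → e ≡ (1ℚ + n * c) * e - (c * e) * n
    small-id = solve 3 (λ c e n → e := (con 1ℚ :+ n :* c) :* e :- (c :* e) :* n) refl

    add-sub-comm : ∀ s t u → (s + t) - u ≡ (s - u) + t
    add-sub-comm = solve 3 (λ s t u → (s :+ t) :- u := (s :- u) :+ t) refl

    tail-id : ∀ c a r → (a - r) + c * r ≡ a - (1ℚ - c) * r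
    tail-id = solve 3 (λ c a r → (a :- r) :+ c :* r := a :- (con 1ℚ :- c) :* r) refl

    sub-sub : ∀ a b → b ≡ a - (a - b)
    sub-sub = solve 2 (λ a b → b := a :- (a :- b)) refl

    rotate-* : ∀ a b w → a * (b * w) ≡ (b * a) * w
    rotate-* = solve 3 (λ a b w → a :* (b :* w) := (b :* a) :* w) refl

    upper-id : ∀ a w e v → (w - e * v) + w ≡ (a + 1ℚ) * w - e * v - (a + - 1ℚ) * w
    upper-id = solve 4 (λ a w e v → (w :- e :* v) :+ w := (a :+ con 1ℚ) :* w :- e :* v :- (a :- con 1ℚ) :* w) refl

    lower-id : ∀ a w e v → (a * w - e * v) + a * w ≡ (a + 1ℚ) * w - e * v - - ((a + - 1ℚ) * w)
    lower-id = solve 4 (λ a w e v → (a :* w :- e :* v) :+ a :* w := (a :+ con 1ℚ) :* w :- e :* v :- :- ((a :- con 1ℚ) :* w)) refl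

  *-pos : ∀ {p q} → 0ℚ < p → 0ℚ < q → 0ℚ < p * q
  *-pos {p} {q} 0<p 0<q = ℚₚ.positive⁻¹ _
    {{ℚₚ.pos*pos⇒pos p {{ℚ.positive 0<p}} q {{ℚ.positive 0<q}}}}

  +-pos : ∀ {p q} → 0ℚ < p → 0ℚ < q → 0ℚ < p + q
  +-pos {p} {q} 0<p 0<q = ℚₚ.positive⁻¹ _
    {{ℚₚ.pos+pos⇒pos p {{ℚ.positive 0<p}} q {{ℚ.positive 0<q}}}}

  *-mono : ∀ {p q r s} → 0ℚ ≤ p → 0ℚ ≤ s → p ≤ q → r ≤ s → p * r ≤ q * s
  *-mono {p} {q} {r} {s} 0≤p 0≤s p≤q r≤s = ℚₚ.≤-trans
    (ℚₚ.*-monoˡ-≤-nonNeg p {{ℚ.nonNegative 0≤p}} r≤s)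
    (ℚₚ.*-monoʳ-≤-nonNeg s {{ℚ.nonNegative 0≤s}} p≤q)

  ∣-∣-mono-* : ∀ {p q P Q} → ∣ p ∣ ≤ P → ∣ q ∣ ≤ Q → ∣ p * q ∣ ≤ P * Q
  ∣-∣-mono-* {p} {q} {P} {Q} hp hq = subst (_≤ P * Q) (sym (ℚₚ.∣p*q∣≡∣p∣*∣q∣ p q))
    (*-mono (ℚₚ.0≤∣p∣ p) (ℚₚ.≤-trans (ℚₚ.0≤∣p∣ q) hq) hp hq)

  ∣-∣-mono-+ : ∀ {p q P Q} → ∣ p ∣ ≤ P → ∣ q ∣ ≤ Q → ∣ p + q ∣ ≤ P + Q
  ∣-∣-mono-+ {p} {q} hp hq = ℚₚ.≤-trans (ℚₚ.∣p+q∣≤∣p∣+∣q∣ p q) (ℚₚ.+-mono-≤ hp hq)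

  ∣-∣-sym : ∀ p q → ∣ p - q ∣ ≡ ∣ q - p ∣
  ∣-∣-sym p q = trans (cong ∣_∣ (neg-swap p q))
                      (ℚₚ.∣-p∣≡∣p∣ (q - p))

  p≤∣p∣ : ∀ p → p ≤ ∣ p ∣
  p≤∣p∣ p with ℚₚ.≤-total 0ℚ p
  ... | inj₁ 0≤p = ℚₚ.≤-reflexive (sym (ℚₚ.0≤p⇒∣p∣≡p 0≤p))
  ... | inj₂ p≤0 = ℚₚ.≤-trans p≤0 (ℚₚ.0≤∣p∣ p)

  ∣-∣-bound : ∀ {p q} → p ≤ q → - p ≤ q → ∣ p ∣ ≤ q
  ∣-∣-bound {p} h h′ with ℚₚ.∣p∣≡p∨∣p∣≡-p p
  ... | inj₁ eq = subst (_≤ _) (sym eq) h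
  ... | inj₂ eq = subst (_≤ _) (sym eq) h′

  from-nonneg : ∀ {p q} → 0ℚ ≤ q - p → p ≤ q
  from-nonneg {p} {q} h = subst₂ _≤_ (ℚₚ.+-identityʳ p)
    (add-sub p q) (ℚₚ.+-monoʳ-≤ p h)

  *-nonneg : ∀ {p q} → 0ℚ ≤ p → 0ℚ ≤ q → 0ℚ ≤ p * q
  *-nonneg {p} {q} 0≤p 0≤q = ℚₚ.nonNegative⁻¹ _
    {{ℚₚ.nonNeg*nonNeg⇒nonNeg p {{ℚ.nonNegative 0≤p}} q {{ℚ.nonNegative 0≤q}}}}

  0<1 : 0ℚ < 1ℚ
  0<1 = ℚₚ.positive⁻¹ 1ℚ

  recip : ∀ q → 0ℚ < q → ℚ
  recip q 0<q = (1/ q) {{ℚ.>-nonZero 0<q}}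

  recip-pos : ∀ q (0<q : 0ℚ < q) → 0ℚ < recip q 0<q
  recip-pos q 0<q = ℚₚ.positive⁻¹ _ {{ℚₚ.1/pos⇒pos q {{ℚ.positive 0<q}}}}

  recip-invʳ : ∀ q (0<q : 0ℚ < q) → q * recip q 0<q ≡ 1ℚ
  recip-invʳ q 0<q = ℚₚ.*-inverseʳ q {{ℚ.>-nonZero 0<q}}

  recip-anti : ∀ {p q} (0<p : 0ℚ < p) (0<q : 0ℚ < q) → p ≤ q → recip q 0<q ≤ recip p 0<p
  recip-anti {p} {q} 0<p 0<q p≤q = subst₂ _≤_ eq₁ eq₂
      (ℚₚ.*-monoʳ-≤-nonNeg (p′ * q′) {{ℚ.nonNegative (ℚₚ.<⇒≤ (*-pos (recip-pos p 0<p) (recip-pos q 0<q)))}} p≤q)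
    where
    p′ = recip p 0<p
    q′ = recip q 0<q
    eq₁ : p * (p′ * q′) ≡ q′
    eq₁ = trans (sym (ℚₚ.*-assoc p p′ q′))
            (trans (cong (_* q′) (recip-invʳ p 0<p)) (ℚₚ.*-identityˡ q′))
    eq₂ : q * (p′ * q′) ≡ p′
    eq₂ = trans (swap-* q p′ q′)
            (trans (cong (p′ *_) (recip-invʳ q 0<q)) (ℚₚ.*-identityʳ p′))

  recip-diff : ∀ {p q} (0<p : 0ℚ < p) (0<q : 0ℚ < q) →
               recip p 0<p - recip q 0<q ≡ (recip p 0<p * recip q 0<q) * (q - p)
  recip-diff {p} {q} 0<p 0<q = sym (trans
      (recip-id p q p′ q′)
      (cong₂ _-_ (trans (cong (p′ *_) (recip-invʳ q 0<q)) (ℚₚ.*-identityʳ p′))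
                 (trans (cong (q′ *_) (recip-invʳ p 0<p)) (ℚₚ.*-identityʳ q′))))
    where
    p′ = recip p 0<p
    q′ = recip q 0<q

  rescale : ∀ (x : ℕ → ℚ) K → 0ℚ < K →
    (∀ δ → 0ℚ < δ → ∃[ N ] (∀ m n → N ℕ.≤ m → N ℕ.≤ n → ∣ x m - x n ∣ ≤ K * δ)) →
    IsCauchy x
  rescale x K 0<K h δ 0<δ =
    let (N , hN) = h (recip K 0<K * δ) (*-pos (recip-pos K 0<K) 0<δ)
    in N , λ m n N≤m N≤n → subst (_ ≤_)
    (trans (sym (ℚₚ.*-assoc K _ δ))
      (trans (cong (_* δ) (recip-invʳ K 0<K)) (ℚₚ.*-identityˡ δ)))
    (hN m n N≤m N≤n)

  abstract
    cauchy-const : ∀ q → IsCauchy (λ _ → q)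
    cauchy-const q δ 0<δ = 0 , λ _ _ _ _ →
      subst (λ r → ∣ r ∣ ≤ δ) (sym (ℚₚ.+-inverseʳ q)) (ℚₚ.<⇒≤ 0<δ)

  abstract
    cauchy-+ : ∀ x y → IsCauchy x → IsCauchy y → IsCauchy (λ n → x n + y n)
    cauchy-+ x y cx cy = rescale (λ n → x n + y n) (1ℚ + 1ℚ) (ℚₚ.positive⁻¹ (1ℚ + 1ℚ)) λ δ 0<δ →
      let (M , hM) = cx δ 0<δ
          (N , hN) = cy δ 0<δ
      in M ⊔ N , λ m n le le′ → subst₂ _≤_
        (cong ∣_∣ (sum-diff (x m) (y m) (x n) (y n)))
        (double δ)
        (∣-∣-mono-+ (hM m n (ℕₚ.m⊔n≤o⇒m≤o M N le) (ℕₚ.m⊔n≤o⇒m≤o M N le′))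
                    (hN m n (ℕₚ.m⊔n≤o⇒n≤o M N le) (ℕₚ.m⊔n≤o⇒n≤o M N le′)))

  abstract
    cauchy-neg : ∀ x → IsCauchy x → IsCauchy (λ n → - x n)
    cauchy-neg x cx δ 0<δ =
      let (N , hN) = cx δ 0<δ
      in N , λ m n le le′ → subst (_≤ δ)
      (trans (sym (ℚₚ.∣-p∣≡∣p∣ (x m - x n)))
        (cong ∣_∣ (neg-diff (x m) (x n))))
      (hN m n le le′)

  abstract
    bounded : ∀ x → IsCauchy x →
              ∃[ B ] 0ℚ < B × Eventually (λ n → ∣ x n ∣ ≤ B)
    bounded x cx = let (N , hN) = cx 1ℚ 0<1 in
      1ℚ + ∣ x N ∣ ,
      ℚₚ.<-≤-trans 0<1 (subst (_≤ 1ℚ + ∣ x N ∣) (ℚₚ.+-identityʳ 1ℚ) (ℚₚ.+-monoʳ-≤ 1ℚ (ℚₚ.0≤∣p∣ (x N)))) ,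
      N , λ n le → subst (λ r → ∣ r ∣ ≤ 1ℚ + ∣ x N ∣)
        (sub-add (x n) (x N))
        (∣-∣-mono-+ (hN n N le ℕₚ.≤-refl) ℚₚ.≤-refl)

  product-bound : ∀ {a b c d A B δ} → ∣ a ∣ ≤ A → ∣ d ∣ ≤ B → ∣ a - c ∣ ≤ δ → ∣ b - d ∣ ≤ δ →
                  ∣ a * b - c * d ∣ ≤ (A + B) * δ
  product-bound {a} {b} {c} {d} {A} {B} {δ} ha hd hac hbd = begin
    ∣ a * b - c * d ∣                    ≡⟨ cong ∣_∣ (prod-diff a b c d) ⟨
    ∣ a * (b - d) + d * (a - c) ∣        ≤⟨ ∣-∣-mono-+ {a * (b - d)} {d * (a - c)}
                                              (∣-∣-mono-* {a} {b - d} ha hbd)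
                                              (∣-∣-mono-* {d} {a - c} hd hac) ⟩
    A * δ + B * δ                        ≡⟨ ℚₚ.*-distribʳ-+ δ A B ⟨
    (A + B) * δ                          ∎
    where open ℚₚ.≤-Reasoning

  abstract
    cauchy-* : ∀ x y → IsCauchy x → IsCauchy y → IsCauchy (λ n → x n * y n)
    cauchy-* x y cx cy =
      let (A , 0<A , L , hL) = bounded x cx
          (B , 0<B , P , hP) = bounded y cy
      in rescale (λ n → x n * y n) (A + B) (+-pos 0<A 0<B) λ δ 0<δ →
      let (M , hM) = cx δ 0<δ
          (N , hN) = cy δ 0<δ
          S = (L ⊔ P) ⊔ (M ⊔ N)
      in S , λ m n le le′ →
        let lp = ℕₚ.m⊔n≤o⇒m≤o (L ⊔ P) (M ⊔ N) le
            lp′ = ℕₚ.m⊔n≤o⇒m≤o (L ⊔ P) (M ⊔ N) le′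
            mn = ℕₚ.m⊔n≤o⇒n≤o (L ⊔ P) (M ⊔ N) le
            mn′ = ℕₚ.m⊔n≤o⇒n≤o (L ⊔ P) (M ⊔ N) le′
        in product-bound {x m} {y m} {x n} {y n}
          (hL m (ℕₚ.m⊔n≤o⇒m≤o L P lp))
          (hP n (ℕₚ.m⊔n≤o⇒n≤o L P lp′))
          (hM m n (ℕₚ.m⊔n≤o⇒m≤o M N mn) (ℕₚ.m⊔n≤o⇒m≤o M N mn′))
          (hN m n (ℕₚ.m⊔n≤o⇒n≤o M N mn) (ℕₚ.m⊔n≤o⇒n≤o M N mn′))

  -- For δ a positive eventual lower bound of x, the maximum is eventually x n.

  clamp-pos : ∀ q {δ} → 0ℚ < δ → 0ℚ < q ℚ.⊔ δ
  clamp-pos q {δ} 0<δ = ℚₚ.<-≤-trans 0<δ (ℚₚ.p≤q⊔p q δ)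

  clampRecip : ∀ {δ} → 0ℚ < δ → ℚ → ℚ
  clampRecip {δ} 0<δ q = recip (q ℚ.⊔ δ) (clamp-pos q 0<δ)

  clampRecip-pos : ∀ {δ} (0<δ : 0ℚ < δ) q → 0ℚ < clampRecip 0<δ q
  clampRecip-pos {δ} 0<δ q = recip-pos (q ℚ.⊔ δ) (clamp-pos q 0<δ)

  clampRecip-bound : ∀ {δ} (0<δ : 0ℚ < δ) q → ∣ clampRecip 0<δ q ∣ ≤ recip δ 0<δ
  clampRecip-bound {δ} 0<δ q = subst (_≤ recip δ 0<δ)
    (sym (ℚₚ.0≤p⇒∣p∣≡p (ℚₚ.<⇒≤ (clampRecip-pos 0<δ q))))
    (recip-anti 0<δ (clamp-pos q 0<δ) (ℚₚ.p≤q⊔p q δ))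

  clampRecip-inv : ∀ {δ} (0<δ : 0ℚ < δ) q → δ ≤ q → q * clampRecip 0<δ q ≡ 1ℚ
  clampRecip-inv {δ} 0<δ q δ≤q = trans
    (cong (_* clampRecip 0<δ q) (sym (ℚₚ.p≥q⇒p⊔q≡p δ≤q)))
    (recip-invʳ (q ℚ.⊔ δ) (clamp-pos q 0<δ))

  clampRecip-lower : ∀ {δ} (0<δ : 0ℚ < δ) q {B} (0<B : 0ℚ < B) →
                     δ ≤ q → q ≤ B → recip B 0<B ≤ clampRecip 0<δ q
  clampRecip-lower {δ} 0<δ q 0<B δ≤q q≤B =
    recip-anti (clamp-pos q 0<δ) 0<B (subst (_≤ _) (sym (ℚₚ.p≥q⇒p⊔q≡p δ≤q)) q≤B)

  abstract
    cauchy-recip : ∀ x {δ} (0<δ : 0ℚ < δ) → IsCauchy x → Eventually (λ n → δ ≤ x n) →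
                   IsCauchy (λ n → clampRecip 0<δ (x n))
    cauchy-recip x {δ} 0<δ cx (L , hL) =
      rescale (λ n → clampRecip 0<δ (x n)) (δ′ * δ′) (*-pos (recip-pos δ 0<δ) (recip-pos δ 0<δ)) λ η 0<η →
        let (M , hM) = cx η 0<η
        in L ⊔ M , λ m n le le′ → subst (λ r → ∣ r ∣ ≤ (δ′ * δ′) * η)
          (sym (trans (recip-diff (clamp-pos (x m) 0<δ) (clamp-pos (x n) 0<δ))
            (cong₂ (λ a b → (clampRecip 0<δ (x m) * clampRecip 0<δ (x n)) * (a - b))
              (ℚₚ.p≥q⇒p⊔q≡p (hL n (ℕₚ.m⊔n≤o⇒m≤o L M le′)))
              (ℚₚ.p≥q⇒p⊔q≡p (hL m (ℕₚ.m⊔n≤o⇒m≤o L M le))))))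
          (∣-∣-mono-*
            (∣-∣-mono-* (clampRecip-bound 0<δ (x m)) (clampRecip-bound 0<δ (x n)))
            (hM n m (ℕₚ.m⊔n≤o⇒n≤o L M le′) (ℕₚ.m⊔n≤o⇒n≤o L M le)))
      where
      δ′ : ℚ
      δ′ = recip δ 0<δ

  cauchy-^ : ∀ x k → IsCauchy x → IsCauchy (λ n → x n ^ k)
  cauchy-^ x zero    cx = cauchy-const 1ℚ
  cauchy-^ x (suc k) cx = cauchy-* x (λ n → x n ^ k) cx (cauchy-^ x k cx)

  cauchy-artanhSum : ∀ x k → IsCauchy x → IsCauchy (λ n → artanhSum k (x n))
  cauchy-artanhSum x zero    cx = cauchy-const 0ℚ
  cauchy-artanhSum x (suc k) cx =
    cauchy-+ (λ n → artanhSum k (x n)) (λ n → x n ^ suc (2 ℕ.* k) * w)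
      (cauchy-artanhSum x k cx)
      (cauchy-* (λ n → x n ^ suc (2 ℕ.* k)) (λ _ → w)
        (cauchy-^ x (suc (2 ℕ.* k)) cx) (cauchy-const w))
    where w = ℤ.+ 1 ℚ./ suc (2 ℕ.* k)

  cauchy-diagonal : ∀ (f : ℕ → ℕ → ℚ) → (∀ k → IsCauchy (f k)) →
    (∀ δ → 0ℚ < δ → ∃[ N ] Eventually (λ n → ∣ f n n - f N n ∣ ≤ δ)) →
    IsCauchy (λ n → f n n)
  cauchy-diagonal f cf tail =
    rescale (λ n → f n n) (1ℚ + 1ℚ + 1ℚ) (ℚₚ.positive⁻¹ (1ℚ + 1ℚ + 1ℚ)) λ δ 0<δ →
      let (N , M , hM) = tail δ 0<δ
          (L , hL) = cf N δ 0<δ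
      in M ⊔ L , λ m n le le′ → subst₂ _≤_
        (cong ∣_∣ (chain (f m m) (f N m) (f N n) (f n n)))
        (triple δ)
        (∣-∣-mono-+ (∣-∣-mono-+
          (hM m (ℕₚ.m⊔n≤o⇒m≤o M L le))
          (hL m n (ℕₚ.m⊔n≤o⇒n≤o M L le) (ℕₚ.m⊔n≤o⇒n≤o M L le′)))
          (subst (_≤ δ) (∣-∣-sym (f n n) (f N n)) (hM n (ℕₚ.m⊔n≤o⇒m≤o M L le′))))

  fromℕ : ℕ → ℚ
  fromℕ zero    = 0ℚ
  fromℕ (suc n) = 1ℚ + fromℕ n

  fromℕ-nonneg : ∀ n → 0ℚ ≤ fromℕ n
  fromℕ-nonneg zero    = ℚₚ.≤-refl
  fromℕ-nonneg (suc n) = ℚₚ.+-mono-≤ (ℚₚ.<⇒≤ 0<1) (fromℕ-nonneg n)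

  fromℕ-/ : ∀ n → fromℕ n ≡ ℤ.+ n ℚ./ 1
  fromℕ-/ zero = refl
  fromℕ-/ (suc n) = trans (cong (1ℚ +_) (fromℕ-/ n)) (ℚₚ.toℚᵘ-injective eq)
    where
    open import Data.Rational.Unnormalised.Base as ℚᵘ using (mkℚᵘ; *≡*)
    import Data.Rational.Unnormalised.Properties as ℚᵘₚ
    eq : ℚ.toℚᵘ (1ℚ + ℤ.+ n ℚ./ 1) ℚᵘ.≃ ℚ.toℚᵘ (ℤ.+ suc n ℚ./ 1)
    eq = ℚᵘₚ.≃-trans (ℚₚ.toℚᵘ-homo-+ 1ℚ (ℤ.+ n ℚ./ 1))
         (ℚᵘₚ.≃-trans (ℚᵘₚ.+-congʳ (ℚ.toℚᵘ 1ℚ) (ℚₚ.toℚᵘ-fromℚᵘ (mkℚᵘ (ℤ.+ n) 0)))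
         (ℚᵘₚ.≃-trans (*≡* (cong (ℤ._* ℤ.+ 1) (cong (ℤ._+_ (ℤ.+ 1)) (ℤₚ.*-identityʳ (ℤ.+ n)))))
           (ℚᵘₚ.≃-sym (ℚₚ.toℚᵘ-fromℚᵘ (mkℚᵘ (ℤ.+ suc n) 0)))))

  archimedean : ∀ q → ∃[ n ] q ≤ fromℕ n
  archimedean q@(ℚ.mkℚ i d _) = ℤ.∣ i ∣ , subst (q ≤_) (sym (fromℕ-/ ℤ.∣ i ∣))
      (ℚₚ.toℚᵘ-cancel-≤ (ℚᵘₚ.≤-respʳ-≃ (ℚᵘₚ.≃-sym (ℚₚ.toℚᵘ-fromℚᵘ (mkℚᵘ (ℤ.+ ℤ.∣ i ∣) 0)))
        (*≤* (bound i))))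
    where
    open import Data.Rational.Unnormalised.Base using (mkℚᵘ; *≤*)
    import Data.Rational.Unnormalised.Properties as ℚᵘₚ
    bound : ∀ i → i ℤ.* ℤ.+ 1 ℤ.≤ ℤ.+ ℤ.∣ i ∣ ℤ.* ℤ.+ suc d
    bound (ℤ.+ n) = subst₂ ℤ._≤_ (sym (ℤₚ.*-identityʳ (ℤ.+ n))) (ℤₚ.pos-* n (suc d))
      (ℤ.+≤+ (ℕₚ.m≤m*n n (suc d)))
    bound ℤ.-[1+ n ] = subst (ℤ.-[1+ n ] ℤ.* ℤ.+ 1 ℤ.≤_) (ℤₚ.pos-* (suc n) (suc d)) ℤ.-≤+

  module _ {c : ℚ} (0<c : 0ℚ < c) (0≤q : 0ℚ ≤ 1ℚ - c) where

    private
      q = 1ℚ - c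

      q≤1 : q ≤ 1ℚ
      q≤1 = from-nonneg (subst (0ℚ ≤_)
        (one-minus c) (ℚₚ.<⇒≤ 0<c))

    q^-nonneg : ∀ k → 0ℚ ≤ q ^ k
    q^-nonneg zero    = ℚₚ.<⇒≤ 0<1
    q^-nonneg (suc k) = *-nonneg 0≤q (q^-nonneg k)

    q^-step : ∀ k → q ^ suc k ≤ q ^ k
    q^-step k = subst (q ^ suc k ≤_) (ℚₚ.*-identityˡ (q ^ k))
      (*-mono 0≤q (q^-nonneg k) q≤1 ℚₚ.≤-refl)

    q^-anti : ∀ k j → q ^ (j ℕ.+ k) ≤ q ^ k
    q^-anti k zero    = ℚₚ.≤-refl
    q^-anti k (suc j) = ℚₚ.≤-trans (q^-step (j ℕ.+ k)) (q^-anti k j)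

    bernoulli : ∀ k → q ^ k * (1ℚ + fromℕ k * c) ≤ 1ℚ
    bernoulli zero = ℚₚ.≤-reflexive
      (bernoulli-base c)
    bernoulli (suc k) = ℚₚ.≤-trans (from-nonneg (subst (0ℚ ≤_)
        (bernoulli-id c (fromℕ k) (q ^ k))
        (*-nonneg (q^-nonneg k) (*-nonneg (fromℕ-nonneg (suc k))
          (ℚₚ.<⇒≤ (*-pos 0<c 0<c))))))
      (bernoulli k)

    q^-small : ∀ η → 0ℚ < η → ∃[ k ] q ^ k ≤ η
    q^-small η 0<η = k , ℚₚ.≤-trans (subst₂ _≤_ (ℚₚ.*-identityʳ (q ^ k)) refl
            (ℚₚ.*-monoˡ-≤-nonNeg (q ^ k) {{ℚ.nonNegative (q^-nonneg k)}} one≤))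
          (subst₂ _≤_ (ℚₚ.*-assoc (q ^ k) _ η) (ℚₚ.*-identityˡ η)
            (ℚₚ.*-monoʳ-≤-nonNeg η {{ℚ.nonNegative (ℚₚ.<⇒≤ 0<η)}} (bernoulli k)))
      where
      open ℚₚ.≤-Reasoning
      0<cη = *-pos 0<c 0<η
      k = proj₁ (archimedean (recip (c * η) 0<cη))
      hk = proj₂ (archimedean (recip (c * η) 0<cη))
      one≤ : 1ℚ ≤ (1ℚ + fromℕ k * c) * η
      one≤ = begin
        1ℚ                             ≡⟨ recip-invʳ (c * η) 0<cη ⟨
        (c * η) * recip (c * η) 0<cη   ≤⟨ ℚₚ.*-monoˡ-≤-nonNeg (c * η) {{ℚ.nonNegative (ℚₚ.<⇒≤ 0<cη)}} hk ⟩
        (c * η) * fromℕ k              ≤⟨ from-nonneg (subst (0ℚ ≤_)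
            (small-id c η (fromℕ k))
            (ℚₚ.<⇒≤ 0<η)) ⟩
        (1ℚ + fromℕ k * c) * η         ∎

    module _ {z : ℚ} (∣z∣≤q : ∣ z ∣ ≤ q) where

      z^-bound : ∀ k → ∣ z ^ k ∣ ≤ q ^ k
      z^-bound zero    = ℚₚ.≤-refl
      z^-bound (suc k) = ∣-∣-mono-* ∣z∣≤q (z^-bound k)

      unit-fraction : ∀ d → ∣ ℤ.+ 1 ℚ./ suc d ∣ ≤ 1ℚ
      unit-fraction d = subst (_≤ 1ℚ)
        (sym (ℚₚ.0≤p⇒∣p∣≡p (ℚₚ.nonNegative⁻¹ _ {{ℚₚ.normalize-nonNeg 1 (suc d)}})))
        (ℚₚ.toℚᵘ-cancel-≤ (ℚᵘₚ.≤-respˡ-≃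
          (ℚᵘₚ.≃-sym (ℚₚ.toℚᵘ-fromℚᵘ (mkℚᵘ (ℤ.+ 1) d)))
          (*≤* (ℤ.+≤+ (ℕ.s≤s ℕ.z≤n)))))
        where
        open import Data.Rational.Unnormalised.Base using (mkℚᵘ; *≤*)
        import Data.Rational.Unnormalised.Properties as ℚᵘₚ

      term-bound : ∀ k → ∣ z ^ suc (2 ℕ.* k) * (ℤ.+ 1 ℚ./ suc (2 ℕ.* k)) ∣ ≤ q ^ k
      term-bound k = ℚₚ.≤-trans
        (∣-∣-mono-* {z ^ suc (2 ℕ.* k)} (z^-bound (suc (2 ℕ.* k))) (unit-fraction (2 ℕ.* k)))
        (subst₂ _≤_
          (trans (cong (λ j → q ^ suc j) (ℕₚ.+-comm (k ℕ.+ 0) k)) (sym (ℚₚ.*-identityʳ _)))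
          refl (q^-anti k (suc (k ℕ.+ 0))))

      artanh-tail : ∀ N d → c * ∣ artanhSum (d ℕ.+ N) z - artanhSum N z ∣ ≤ q ^ N - q ^ (d ℕ.+ N)
      artanh-tail N zero = ℚₚ.≤-reflexive (trans
        (cong (λ r → c * ∣ r ∣) (ℚₚ.+-inverseʳ (artanhSum N z)))
        (trans (ℚₚ.*-zeroʳ c) (sym (ℚₚ.+-inverseʳ (q ^ N)))))
      artanh-tail N (suc d) = begin
        c * ∣ (s + t) - s₀ ∣        ≡⟨ cong (λ r → c * ∣ r ∣)
            (add-sub-comm s t s₀) ⟩
        c * ∣ (s - s₀) + t ∣        ≤⟨ mono (∣-∣-mono-+ {s - s₀} ℚₚ.≤-refl (term-bound (d ℕ.+ N))) ⟩
        c * (∣ s - s₀ ∣ + r)        ≡⟨ ℚₚ.*-distribˡ-+ c _ r ⟩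
        c * ∣ s - s₀ ∣ + c * r      ≤⟨ ℚₚ.+-monoˡ-≤ (c * r) (artanh-tail N d) ⟩
        (q ^ N - r) + c * r         ≡⟨ tail-id c (q ^ N) r ⟩
        q ^ N - q * r               ∎
        where
        open ℚₚ.≤-Reasoning
        s₀ = artanhSum N z
        s  = artanhSum (d ℕ.+ N) z
        t  = z ^ suc (2 ℕ.* (d ℕ.+ N)) * (ℤ.+ 1 ℚ./ suc (2 ℕ.* (d ℕ.+ N)))
        r  = q ^ (d ℕ.+ N)
        mono : ∀ {a b} → a ≤ b → c * a ≤ c * b
        mono = ℚₚ.*-monoˡ-≤-nonNeg c {{ℚ.nonNegative (ℚₚ.<⇒≤ 0<c)}}

      artanh-tail′ : ∀ N n → N ℕ.≤ n →
                     ∣ artanhSum n z - artanhSum N z ∣ ≤ recip c 0<c * q ^ N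
      artanh-tail′ N n N≤n = subst₂ _≤_ eq refl
          (ℚₚ.*-monoˡ-≤-nonNeg (recip c 0<c) {{ℚ.nonNegative (ℚₚ.<⇒≤ (recip-pos c 0<c))}}
            (ℚₚ.≤-trans (subst (λ k → c * ∣ artanhSum k z - artanhSum N z ∣ ≤ q ^ N - q ^ k)
                (ℕₚ.m∸n+n≡m N≤n) (artanh-tail N (n ℕ.∸ N)))
              (from-nonneg (subst (0ℚ ≤_)
                (sub-sub (q ^ N) (q ^ n)) (q^-nonneg n)))))
        where
        w = ∣ artanhSum n z - artanhSum N z ∣
        eq : recip c 0<c * (c * w) ≡ w
        eq = trans (rotate-* (recip c 0<c) c w)
          (trans (cong (_* w) (recip-invʳ c 0<c)) (ℚₚ.*-identityˡ w))

  abstract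
    cauchy-artanh : ∀ x {c} → 0ℚ < c → IsCauchy x → Eventually (λ n → ∣ x n ∣ ≤ 1ℚ - c) →
                    IsCauchy (λ n → artanhSum n (x n))
    cauchy-artanh x {c} 0<c cx (M , hM) =
        cauchy-diagonal (λ k n → artanhSum k (x n)) (λ k → cauchy-artanhSum x k cx) λ δ 0<δ →
          let (N , hN) = q^-small 0<c 0≤q (c * δ) (*-pos 0<c 0<δ)
          in N , M ⊔ N , λ n le → ℚₚ.≤-trans
            (artanh-tail′ 0<c 0≤q (hM n (ℕₚ.m⊔n≤o⇒m≤o M N le)) N n (ℕₚ.m⊔n≤o⇒n≤o M N le))
            (subst₂ _≤_ refl
              (trans (sym (ℚₚ.*-assoc c′ c δ))
                (trans (cong (_* δ) (trans (ℚₚ.*-comm c′ c) (recip-invʳ c 0<c))) (ℚₚ.*-identityˡ δ)))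
              (ℚₚ.*-monoˡ-≤-nonNeg c′ {{ℚ.nonNegative (ℚₚ.<⇒≤ (recip-pos c 0<c))}} hN))
      where
      c′ : ℚ
      c′ = recip c 0<c
      0≤q : 0ℚ ≤ 1ℚ - c
      0≤q = ℚₚ.≤-trans (ℚₚ.0≤∣p∣ (x M)) (hM M ℕₚ.≤-refl)

  diff-nonneg : ∀ {p q} → p ≤ q → 0ℚ ≤ q - p
  diff-nonneg {p} {q} h = subst (_≤ q - p) (ℚₚ.+-inverseʳ p) (ℚₚ.+-monoˡ-≤ (- p) h)

  +-nonneg : ∀ {p q} → 0ℚ ≤ p → 0ℚ ≤ q → 0ℚ ≤ p + q
  +-nonneg {p} {q} 0≤p 0≤q = ℚₚ.nonNegative⁻¹ _
    {{ℚₚ.nonNeg+nonNeg⇒nonNeg p {{ℚ.nonNegative 0≤p}} q {{ℚ.nonNegative 0≤q}}}}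

  ⊓-pos : ∀ {p q} → 0ℚ < p → 0ℚ < q → 0ℚ < p ℚ.⊓ q
  ⊓-pos {p} {q} 0<p 0<q with ℚₚ.⊓-sel p q
  ... | inj₁ eq = subst (0ℚ <_) (sym eq) 0<p
  ... | inj₂ eq = subst (0ℚ <_) (sym eq) 0<q

  möbius-step : ∀ {δ δ′ B} (0<δ : 0ℚ < δ) (0<δ′ : 0ℚ < δ′) → 0ℚ < B →
    ∃[ c ] 0ℚ < c × (∀ a → δ ≤ a → δ′ ≤ a + 1ℚ → a ≤ B →
      ∣ (a + - 1ℚ) * clampRecip 0<δ′ (a + 1ℚ) ∣ ≤ 1ℚ - c)
  möbius-step {δ} {δ′} {B} 0<δ 0<δ′ 0<B = c , *-pos 0<e 0<w₀ , bound
    where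
    0<B+1 : 0ℚ < B + 1ℚ
    0<B+1 = +-pos 0<B 0<1
    w₀ e c : ℚ
    w₀ = recip (B + 1ℚ) 0<B+1
    e = δ ℚ.⊓ 1ℚ
    c = e * w₀
    0<w₀ : 0ℚ < w₀
    0<w₀ = recip-pos (B + 1ℚ) 0<B+1
    0<e : 0ℚ < e
    0<e = ⊓-pos 0<δ 0<1
    bound : ∀ a → δ ≤ a → δ′ ≤ a + 1ℚ → a ≤ B →
            ∣ (a + - 1ℚ) * clampRecip 0<δ′ (a + 1ℚ) ∣ ≤ 1ℚ - c
    bound a δ≤a δ′≤ a≤B = ∣-∣-bound
        (from-nonneg (subst (0ℚ ≤_)
          (trans (upper-id a w e w₀) (cong (λ r → r - c - (a + - 1ℚ) * w) inv))
          (+-nonneg (diff-nonneg c≤w) 0≤w)))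
        (from-nonneg (subst (0ℚ ≤_)
          (trans (lower-id a w e w₀) (cong (λ r → r - c - - ((a + - 1ℚ) * w)) inv))
          (+-nonneg (diff-nonneg c≤aw) (*-nonneg 0≤a 0≤w))))
      where
      w : ℚ
      w = clampRecip 0<δ′ (a + 1ℚ)
      0≤w : 0ℚ ≤ w
      0≤w = ℚₚ.<⇒≤ (clampRecip-pos 0<δ′ (a + 1ℚ))
      0≤a : 0ℚ ≤ a
      0≤a = ℚₚ.≤-trans (ℚₚ.<⇒≤ 0<δ) δ≤a
      inv : (a + 1ℚ) * w ≡ 1ℚ
      inv = clampRecip-inv 0<δ′ (a + 1ℚ) δ′≤
      w₀≤w : w₀ ≤ w
      w₀≤w = clampRecip-lower 0<δ′ (a + 1ℚ) 0<B+1 δ′≤ (ℚₚ.+-monoˡ-≤ 1ℚ a≤B)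
      c≤w : c ≤ w
      c≤w = subst (c ≤_) (ℚₚ.*-identityˡ w)
        (*-mono (ℚₚ.<⇒≤ 0<e) 0≤w (ℚₚ.p⊓q≤q δ 1ℚ) w₀≤w)
      c≤aw : c ≤ a * w
      c≤aw = *-mono (ℚₚ.<⇒≤ 0<e) 0≤w (ℚₚ.≤-trans (ℚₚ.p⊓q≤p δ 1ℚ) δ≤a) w₀≤w

  abstract
    -- ∣ (x - 1) / (x + 1) ∣ is eventually bounded away from 1.
    möbius-bound : ∀ x {δ δ′} (0<δ : 0ℚ < δ) (0<δ′ : 0ℚ < δ′) → IsCauchy x →
      Eventually (λ n → δ ≤ x n) → Eventually (λ n → δ′ ≤ x n + 1ℚ) →
      ∃[ c ] 0ℚ < c × Eventually (λ n → ∣ (x n + - 1ℚ) * clampRecip 0<δ′ (x n + 1ℚ) ∣ ≤ 1ℚ - c)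
    möbius-bound x {δ} {δ′} 0<δ 0<δ′ cx (L , hL) (P , hP) =
      let (B , 0<B , M , hM) = bounded x cx
          (c , 0<c , hc) = möbius-step 0<δ 0<δ′ 0<B
      in c , 0<c , (L ⊔ P) ⊔ M , λ n le →
        let lp = ℕₚ.m⊔n≤o⇒m≤o (L ⊔ P) M le
        in hc (x n) (hL n (ℕₚ.m⊔n≤o⇒m≤o L P lp)) (hP n (ℕₚ.m⊔n≤o⇒n≤o L P lp))
             (ℚₚ.≤-trans (p≤∣p∣ (x n)) (hM n (ℕₚ.m⊔n≤o⇒n≤o (L ⊔ P) M le)))

open CauchyLemmas using
  ( cauchy-const; cauchy-+; cauchy-neg; cauchy-*; cauchy-recip; cauchy-artanh
  ; clampRecip; clampRecip-lower; bounded; möbius-bound; recip; recip-pos; p≤∣p∣; 0<1)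

record ℝ : Set where
  constructor mkℝ
  field
    seq    : ℕ → ℚ
    cauchy : IsCauchy seq

open ℝ public

infix 4 _≃_ _≤_ _<_

record _≃_ (x y : ℝ) : Set where
  constructor mk≃
  field close : ∀ δ → 0ℚ ℚ.< δ → Eventually (λ n → ℚ.∣ seq x n ℚ.- seq y n ∣ ℚ.≤ δ)

record _≤_ (x y : ℝ) : Set where
  constructor mk≤
  field below : ∀ δ → 0ℚ ℚ.< δ → Eventually (λ n → seq x n ℚ.≤ seq y n ℚ.+ δ)

record _<_ (x y : ℝ) : Set where
  constructor mk<
  field
    gap       : ℚ
    gap>0     : 0ℚ ℚ.< gap
    separated : Eventually (λ n → seq x n ℚ.+ gap ℚ.≤ seq y n)

open _≃_ public
open _≤_ public
open _<_ public

fromℚ : ℚ → ℝ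
fromℚ q = mkℝ (λ _ → q) (cauchy-const q)

fromℕ : ℕ → ℝ
fromℕ n = fromℚ (ℤ.+ n ℚ./ 1)

0ℝ 1ℝ : ℝ
0ℝ = fromℚ 0ℚ
1ℝ = fromℚ 1ℚ

infixl 6 _+_ _-_
infixl 7 _*_
infix  8 -_

_+_ : ℝ → ℝ → ℝ
x + y = mkℝ (λ n → seq x n ℚ.+ seq y n) (cauchy-+ (seq x) (seq y) (cauchy x) (cauchy y))

-_ : ℝ → ℝ
- x = mkℝ (λ n → ℚ.- seq x n) (cauchy-neg (seq x) (cauchy x))

_-_ : ℝ → ℝ → ℝ
x - y = x + - y

_*_ : ℝ → ℝ → ℝ
x * y = mkℝ (λ n → seq x n ℚ.* seq y n) (cauchy-* (seq x) (seq y) (cauchy x) (cauchy y))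

private
  gap≤ : ∀ {x} (x>0 : 0ℝ < x) → Eventually (λ n → gap x>0 ℚ.≤ seq x n)
  gap≤ {x} x>0 = let (N , h) = separated x>0 in N , λ n le →
    subst (ℚ._≤ seq x n) (ℚₚ.+-identityˡ (gap x>0)) (h n le)

-- The n-th approximation is 1 / (xₙ ⊔ gap), which is 1 / xₙ for all large n.
inv : (x : ℝ) → 0ℝ < x → ℝ
inv x x>0 = mkℝ (λ n → clampRecip (gap>0 x>0) (seq x n))
                (cauchy-recip (seq x) (gap>0 x>0) (cauchy x) (gap≤ x>0))

inv>0 : (x : ℝ) (x>0 : 0ℝ < x) → 0ℝ < inv x x>0
inv>0 x x>0 = let (B , 0<B , M , hM) = bounded (seq x) (cauchy x) ; (N , hN) = gap≤ x>0 in
  mk< (recip B 0<B) (recip-pos B 0<B)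
  (N ⊔ M , λ n le → subst (ℚ._≤ seq (inv x x>0) n) (sym (ℚₚ.+-identityˡ (recip B 0<B)))
    (clampRecip-lower (gap>0 x>0) (seq x n) 0<B
      (hN n (ℕₚ.m⊔n≤o⇒m≤o N M le))
      (ℚₚ.≤-trans (p≤∣p∣ (seq x n)) (hM n (ℕₚ.m⊔n≤o⇒n≤o N M le)))))

1+-pos : (x : ℝ) → 0ℝ < x → 0ℝ < x + 1ℝ
1+-pos x x>0 = let (N , h) = gap≤ x>0 in mk< (gap x>0) (gap>0 x>0)
  (N , λ n le → subst (ℚ._≤ seq x n ℚ.+ 1ℚ)
    (ℚₚ.+-comm (gap x>0) 0ℚ) (ℚₚ.+-mono-≤ (h n le) (ℚₚ.<⇒≤ 0<1)))

-- ln x = 2 artanh ((x - 1) / (x + 1)).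
ln : (x : ℝ) → 0ℝ < x → ℝ
ln x x>0 = fromℚ (1ℚ ℚ.+ 1ℚ) * mkℝ (λ n → artanhSum n (seq z n))
    (let (c , 0<c , bd) = möbius-bound (seq x) (gap>0 x>0) (gap>0 x+1>0) (cauchy x) (gap≤ x>0) (gap≤ x+1>0)
     in cauchy-artanh (seq z) 0<c (cauchy z) bd)
  where
  x+1>0 : 0ℝ < x + 1ℝ
  x+1>0 = 1+-pos x x>0
  z : ℝ
  z = (x - 1ℝ) * inv (x + 1ℝ) x+1>0

ℝ² : Set
ℝ² = ℝ × ℝ

record AxisRectangle : Set where
  field
    x₀ x₁ y₀ y₁ : ℝ
    x₀≤x₁       : x₀ ≤ x₁
    y₀≤y₁       : y₀ ≤ y₁

  points : Pred ℝ² 0ℓ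
  points (x , y) = (x₀ ≤ x × x ≤ x₁) × (y₀ ≤ y × y ≤ y₁)

  area : ℝ
  area = (x₁ - x₀) * (y₁ - y₀)

partialSum : (ℕ → ℝ) → ℕ → ℝ
partialSum f zero    = 0ℝ
partialSum f (suc n) = partialSum f n + f n

_sumsTo_ : (ℕ → ℝ) → ℝ → Set
f sumsTo s = ∀ δ → 0ℝ < δ →
  Eventually (λ n → partialSum f n ≤ s + δ × s ≤ partialSum f n + δ)

-- ε ≤μ₂ A says that the outer Lebesgue measure of A is at least ε: no sequence of
-- axis-parallel rectangles covering A has total area less than ε (covers whose
-- areas do not sum to a real have infinite total area). For measurable A, in
-- particular for rectangles in any position, this is μ₂ A ≥ ε.
_≤μ₂_ : ℝ → Pred ℝ² 0ℓ → Set
ε ≤μ₂ A = (Q : ℕ → AxisRectangle) →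
  (∀ {p} → A p → ∃[ i ] AxisRectangle.points (Q i) p) →
  ∀ s → (λ i → AxisRectangle.area (Q i)) sumsTo s → ε ≤ s

record RangeSpace (X : Set) : Set₁ where
  field
    Point   : Pred X 0ℓ
    Range   : Pred (Pred X 0ℓ) 0ℓ
    Range⊆  : ∀ {R} → Range R → R ⊆ Point

-- A finite net is given by a list of its points; repetitions are allowed, so the
-- length of the list is an upper bound for the cardinality.
IsNet : RangeSpace ℝ² → ℝ → List ℝ² → Set₁
IsNet 𝒮 ε N = All Point N × (∀ R → Range R → ε ≤μ₂ R → Any R N)
  where open RangeSpace 𝒮

-- The closed rectangle with a vertex at corner and sides of lengths a and b in the
-- orthonormal directions (u , v) and (- v , u).
record Rectangle : Set where
  field
    corner : ℝ²
    u v    : ℝ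
    unit   : u * u + v * v ≃ 1ℝ
    a b    : ℝ
    a>0    : 0ℝ < a
    b>0    : 0ℝ < b

  points : Pred ℝ² 0ℓ
  points (x , y) = ∃[ s ] ∃[ t ]
    (0ℝ ≤ s × s ≤ a) × (0ℝ ≤ t × t ≤ b) ×
    x ≃ proj₁ corner + (s * u - t * v) ×
    y ≃ proj₂ corner + (s * v + t * u)

IsBox : Pred (Pred ℝ² 0ℓ) 0ℓ
IsBox R = Σ[ B ∈ Rectangle ] R ≐ Rectangle.points B

ℐ : Pred ℝ 0ℓ
ℐ x = fromℚ (ℚ.- ½) ≤ x × x ≤ fromℚ ½

ℐ² : Pred ℝ² 0ℓ
ℐ² (x , y) = ℐ x × ℐ y

boxSpace : RangeSpace ℝ²
boxSpace = record
  { Point  = ℐ²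
  ; Range  = λ R → IsBox R × R ⊆ ℐ²
  ; Range⊆ = proj₂
  }

{-# OPTIONS --safe #-}

-- The net of level M is the union, over k + j = M, of the 2ᵏ × 2ʲ grids of mesh 2⁻ᵏ × 2⁻ʲ; it has
-- (M + 1) 2ᴹ points. Consider a box whose sides are of order 2⁻ˡ ≥ 2⁻ᵏ. Cutting it across the long
-- side into pieces of diameter of order 2⁻ᵏ, and covering each by a square, shows that its measure is
-- O(2⁻⁽ˡ⁺ᵏ⁾), so l + k is at most log₂ (1/ε) + O(1). If the long side makes an angle of at most 60°
-- with the x-axis, then some grid column of mesh of order 2⁻ˡ passes near the centre of the box and
-- meets it in a segment of length of order 2⁻ᵏ, which contains a point of the grid. The other boxes
-- reduce to this case by exchanging the axes, under which the net is invariant.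
-- As ln is given by the artanh series, the bound M = O(ln (1/ε)) comes from comparing that series with
-- the harmonic one: for z ≥ 1 - 2⁻ᵐ the first 2ᵐ⁻² powers z²ⁱ⁺¹ are at least 1/2.

module Submission where

open import Level using (0ℓ)
open import Data.Nat.Base as ℕ using (ℕ; zero; suc; _⊔_; _⊓_)
import Data.Nat.Properties as ℕₚ
import Data.Integer.Base as ℤ
import Data.Integer.Properties as ℤₚ
open import Data.Rational.Base as ℚ using (ℚ; 0ℚ; 1ℚ; ½)
import Data.Rational.Properties as ℚₚ
open import Data.Rational.Solver using (module +-*-Solver)
open import Data.Rational.Unnormalised.Base using (mkℚᵘ; *≡*)
import Data.Rational.Unnormalised.Properties as ℚᵘₚ
open import Algebra.Definitions.RawSemiring ℚₚ.+-*-rawSemiring using (_^_)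
open import Data.List.Base using (List; []; _∷_; _++_; length; map; upTo; cartesianProduct)
import Data.List.Properties as Listₚ
open import Data.List.Membership.Propositional using (_∈_; lose)
import Data.List.Membership.Propositional.Properties as ∈ₚ
open import Data.List.Relation.Unary.All as All using (All)
import Data.List.Relation.Unary.All.Properties as Allₚ
open import Data.Product.Base using (Σ-syntax; ∃-syntax; _×_; _,_; proj₁; proj₂; swap)
open import Data.Sum.Base as Sum using (_⊎_; inj₁; inj₂)
open import Relation.Binary.PropositionalEquality.Core using (_≡_; refl; sym; trans; cong; cong₂; subst; subst₂)
open import Relation.Nullary.Decidable.Core using (from-yes)
open import Relation.Unary using (Pred; _⊆_)
open import Defs
open +-*-Solver using (solve; _:=_; _:+_; _:*_; _:-_; :-_; con)

private module Q = CauchyLemmas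

-- Order and ring structure of the Cauchy reals

ev-map : ∀ {P R : Pred ℕ 0ℓ} → (∀ n → P n → R n) → Eventually P → Eventually R
ev-map f (N , h) = N , λ n le → f n (h n le)

ev-zip : ∀ {P R S : Pred ℕ 0ℓ} → (∀ n → P n → R n → S n) → Eventually P → Eventually R → Eventually S
ev-zip f (M , g) (N , h) = M ⊔ N , λ n le →
  f n (g n (ℕₚ.m⊔n≤o⇒m≤o M N le)) (h n (ℕₚ.m⊔n≤o⇒n≤o M N le))

-- Most inequalities are proved by certificates: the difference of the two sides is written as a
-- visibly nonnegative expression, which leaves a ring identity for the solver.
cert-ℚ : ∀ {p q} r → 0ℚ ℚ.≤ r → q ≡ p ℚ.+ r → p ℚ.≤ q
cert-ℚ {p} r 0≤r eq = subst₂ ℚ._≤_ (ℚₚ.+-identityʳ p) (sym eq) (ℚₚ.+-monoʳ-≤ p 0≤r)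

0≤½ : 0ℚ ℚ.≤ ½
0≤½ = ℚₚ.nonNegative⁻¹ ½

half-pos : ∀ {δ} → 0ℚ ℚ.< δ → 0ℚ ℚ.< ½ ℚ.* δ
half-pos = Q.*-pos (ℚₚ.positive⁻¹ ½)

gap-pos : ∀ {p q} → p ℚ.< q → 0ℚ ℚ.< q ℚ.- p
gap-pos {p} {q} p<q = subst (ℚ._< q ℚ.- p) (ℚₚ.+-inverseʳ p) (ℚₚ.+-monoˡ-< (ℚ.- p) p<q)

≤-eventual : ∀ {x y} → Eventually (λ n → seq x n ℚ.≤ seq y n) → x ≤ y
≤-eventual {x} {y} h = mk≤ λ δ 0<δ → ev-map (λ n le → ℚₚ.≤-trans le
  (cert-ℚ δ (ℚₚ.<⇒≤ 0<δ) refl)) h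

≤-pointwise : ∀ {x y} → (∀ n → seq x n ℚ.≤ seq y n) → x ≤ y
≤-pointwise h = ≤-eventual (0 , λ n _ → h n)

≤-refl : ∀ {x} → x ≤ x
≤-refl = ≤-pointwise λ _ → ℚₚ.≤-refl

≤-trans : ∀ {x y z} → x ≤ y → y ≤ z → x ≤ z
≤-trans {x} {y} {z} x≤y y≤z = mk≤ λ δ 0<δ →
  ev-zip (λ n p q → ℚₚ.≤-trans p (ℚₚ.≤-trans (ℚₚ.+-monoˡ-≤ (½ ℚ.* δ) q)
      (ℚₚ.≤-reflexive (solve 2 (λ z δ → z :+ con ½ :* δ :+ con ½ :* δ := z :+ δ) refl (seq z n) δ))))
    (below x≤y (½ ℚ.* δ) (half-pos 0<δ)) (below y≤z (½ ℚ.* δ) (half-pos 0<δ))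

≃-eventual : ∀ {x y} → Eventually (λ n → seq x n ≡ seq y n) → x ≃ y
≃-eventual {x} {y} h = mk≃ λ δ 0<δ → ev-map (λ n eq → subst (λ r → ℚ.∣ r ∣ ℚ.≤ δ)
  (sym (trans (cong (ℚ._- seq y n) eq) (ℚₚ.+-inverseʳ (seq y n)))) (ℚₚ.<⇒≤ 0<δ)) h

≃-pointwise : ∀ {x y} → (∀ n → seq x n ≡ seq y n) → x ≃ y
≃-pointwise h = ≃-eventual (0 , λ n _ → h n)

≃-refl : ∀ {x} → x ≃ x
≃-refl = ≃-pointwise λ _ → refl

≃-sym : ∀ {x y} → x ≃ y → y ≃ x
≃-sym {x} {y} x≃y = mk≃ λ δ 0<δ →
  ev-map (λ n → subst (ℚ._≤ δ) (Q.∣-∣-sym (seq x n) (seq y n))) (close x≃y δ 0<δ)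

≃⇒≤ : ∀ {x y} → x ≃ y → x ≤ y
≃⇒≤ {x} {y} x≃y = mk≤ λ δ 0<δ → ev-map (λ n h →
  subst (ℚ._≤ seq y n ℚ.+ δ)
    (solve 2 (λ x y → y :+ (x :- y) := x) refl (seq x n) (seq y n))
    (ℚₚ.+-monoʳ-≤ (seq y n) (ℚₚ.≤-trans (Q.p≤∣p∣ _) h))) (close x≃y δ 0<δ)

-- Equality modulo the ideal generated by z - w.
≃-modulo : ∀ {x y z w} f → z ≃ w →
  (∀ n → seq x n ≡ seq y n ℚ.+ seq f n ℚ.* (seq z n ℚ.- seq w n)) → x ≃ y
≃-modulo {x} {y} {z} {w} f z≃w eq = mk≃ λ δ 0<δ →
  let (B , 0<B , hB) = Q.bounded (seq f) (cauchy f) ; B′ = Q.recip B 0<B in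
  ev-zip (λ n hf hz → subst₂ ℚ._≤_
      (cong ℚ.∣_∣ (trans (solve 2 (λ y t → t := y :+ t :- y) refl (seq y n) _)
        (cong (ℚ._- seq y n) (sym (eq n)))))
      (trans (sym (ℚₚ.*-assoc B B′ δ))
        (trans (cong (ℚ._* δ) (Q.recip-invʳ B 0<B)) (ℚₚ.*-identityˡ δ)))
      (Q.∣-∣-mono-* {seq f n} hf hz))
    hB (close z≃w (B′ ℚ.* δ) (Q.*-pos (Q.recip-pos B 0<B) 0<δ))

-- The identity is asked of the representatives at each index, where the solver for ℚ applies; the
-- sign of `z` is the only analytic input.
≤-cert : ∀ {x y} z → 0ℝ ≤ z → (∀ n → seq y n ≡ seq x n ℚ.+ seq z n) → x ≤ y
≤-cert {x} {y} z 0≤z eq = mk≤ λ δ 0<δ → ev-map (λ n h →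
  subst₂ ℚ._≤_ (ℚₚ.+-identityʳ (seq x n))
    (trans (sym (ℚₚ.+-assoc (seq x n) (seq z n) δ)) (cong (ℚ._+ δ) (sym (eq n))))
    (ℚₚ.+-monoʳ-≤ (seq x n) h)) (below 0≤z δ 0<δ)

+-nonneg : ∀ {x y} → 0ℝ ≤ x → 0ℝ ≤ y → 0ℝ ≤ x + y
+-nonneg {x} {y} 0≤x 0≤y =
  ≤-trans 0≤x (≤-cert y 0≤y (λ _ → refl))

≤-cert₂ : ∀ {x y} z w → 0ℝ ≤ z → 0ℝ ≤ w →
  (∀ n → seq y n ≡ seq x n ℚ.+ (seq z n ℚ.+ seq w n)) → x ≤ y
≤-cert₂ z w 0≤z 0≤w = ≤-cert (z + w) (+-nonneg 0≤z 0≤w)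

-- A nonnegative real may have slightly negative representatives. A negative factor has absolute
-- value at most `η`, so the product falls below zero by at most `A * η` or `B * η`.
*-nonneg-approx : ∀ {p q A B η} → 0ℚ ℚ.≤ η → ℚ.∣ p ∣ ℚ.≤ A → ℚ.∣ q ∣ ℚ.≤ B →
  0ℚ ℚ.≤ p ℚ.+ η → 0ℚ ℚ.≤ q ℚ.+ η → 0ℚ ℚ.≤ p ℚ.* q ℚ.+ (A ℚ.+ B) ℚ.* η
*-nonneg-approx {p} {q} {A} {B} {η} 0≤η hp hq p≥ q≥ = cases (ℚₚ.≤-total 0ℚ p) (ℚₚ.≤-total 0ℚ q)
  where
  0≤A = ℚₚ.≤-trans (ℚₚ.0≤∣p∣ p) hp
  0≤B = ℚₚ.≤-trans (ℚₚ.0≤∣p∣ q) hq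
  small : ∀ {r} → r ℚ.≤ 0ℚ → 0ℚ ℚ.≤ r ℚ.+ η → ℚ.∣ r ∣ ℚ.≤ η
  small {r} r≤0 r≥ = Q.∣-∣-bound (ℚₚ.≤-trans r≤0 0≤η)
    (cert-ℚ (r ℚ.+ η) r≥ (solve 2 (λ r η → η := :- r :+ (r :+ η)) refl r η))
  finish : ∀ {C D} → 0ℚ ℚ.≤ D → ℚ.∣ p ℚ.* q ∣ ℚ.≤ C → C ℚ.+ D ≡ (A ℚ.+ B) ℚ.* η →
    0ℚ ℚ.≤ p ℚ.* q ℚ.+ (A ℚ.+ B) ℚ.* η
  finish {C} {D} 0≤D h eq = subst (λ r → 0ℚ ℚ.≤ p ℚ.* q ℚ.+ r) eq
    (subst (0ℚ ℚ.≤_) (solve 3 (λ m C D → (C :- :- m) :+ D := m :+ (C :+ D)) refl (p ℚ.* q) C D)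
      (Q.+-nonneg (Q.diff-nonneg (ℚₚ.≤-trans (Q.p≤∣p∣ (ℚ.- (p ℚ.* q)))
        (subst (ℚ._≤ C) (sym (ℚₚ.∣-p∣≡∣p∣ (p ℚ.* q))) h))) 0≤D))
  cases : 0ℚ ℚ.≤ p ⊎ p ℚ.≤ 0ℚ → 0ℚ ℚ.≤ q ⊎ q ℚ.≤ 0ℚ → 0ℚ ℚ.≤ p ℚ.* q ℚ.+ (A ℚ.+ B) ℚ.* η
  cases (inj₁ 0≤p) (inj₁ 0≤q) = Q.+-nonneg (Q.*-nonneg 0≤p 0≤q) (Q.*-nonneg (Q.+-nonneg 0≤A 0≤B) 0≤η)
  cases (inj₂ p≤0) _ = finish (Q.*-nonneg 0≤A 0≤η)
    (Q.∣-∣-mono-* {p} (small p≤0 p≥) hq)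
    (solve 3 (λ A B η → η :* B :+ A :* η := (A :+ B) :* η) refl A B η)
  cases (inj₁ _) (inj₂ q≤0) = finish (Q.*-nonneg 0≤B 0≤η)
    (Q.∣-∣-mono-* {p} hp (small q≤0 q≥))
    (solve 3 (λ A B η → A :* η :+ B :* η := (A :+ B) :* η) refl A B η)

*-nonneg : ∀ {x y} → 0ℝ ≤ x → 0ℝ ≤ y → 0ℝ ≤ x * y
*-nonneg {x} {y} 0≤x 0≤y = mk≤ λ δ 0<δ →
  let (A , 0<A , hA) = Q.bounded (seq x) (cauchy x)
      (B , 0<B , hB) = Q.bounded (seq y) (cauchy y)
      0<K = Q.+-pos 0<A 0<B ; K = A ℚ.+ B ; K′ = Q.recip K 0<K
      η = K′ ℚ.* δ ; 0<η = Q.*-pos (Q.recip-pos K 0<K) 0<δ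
  in ev-zip (λ n hx hy → subst (λ r → 0ℚ ℚ.≤ seq x n ℚ.* seq y n ℚ.+ r)
        (trans (sym (ℚₚ.*-assoc K K′ δ)) (trans (cong (ℚ._* δ) (Q.recip-invʳ K 0<K)) (ℚₚ.*-identityˡ δ)))
        (*-nonneg-approx (ℚₚ.<⇒≤ 0<η) (proj₁ hx) (proj₁ hy) (proj₂ hx) (proj₂ hy)))
      (ev-zip (λ _ → _,_) hA (below 0≤x η 0<η))
      (ev-zip (λ _ → _,_) hB (below 0≤y η 0<η))

diff-nonneg : ∀ {x y} → x ≤ y → 0ℝ ≤ y - x
diff-nonneg {x} {y} x≤y = mk≤ λ δ 0<δ → ev-map (λ n h →
  subst (0ℚ ℚ.≤_) (solve 3 (λ x y δ → y :+ δ :- x := y :- x :+ δ) refl (seq x n) (seq y n) δ)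
    (Q.diff-nonneg h)) (below x≤y δ 0<δ)

square-nonneg : ∀ x → 0ℝ ≤ x * x
square-nonneg x = ≤-pointwise λ n → sq (seq x n)
  where
  sq : ∀ p → 0ℚ ℚ.≤ p ℚ.* p
  sq p with ℚₚ.≤-total 0ℚ p
  ... | inj₁ 0≤p = Q.*-nonneg 0≤p 0≤p
  ... | inj₂ p≤0 = subst (0ℚ ℚ.≤_) (solve 1 (λ p → (con 0ℚ :- p) :* (con 0ℚ :- p) := p :* p) refl p)
    (Q.*-nonneg (Q.diff-nonneg p≤0) (Q.diff-nonneg p≤0))

fromℚ-mono : ∀ {p q} → p ℚ.≤ q → fromℚ p ≤ fromℚ q
fromℚ-mono p≤q = ≤-pointwise λ _ → p≤q

<⇒≤ : ∀ {x y} → x < y → x ≤ y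
<⇒≤ {x} x<y = ≤-eventual (ev-map (λ n → ℚₚ.≤-trans
  (cert-ℚ (gap x<y) (ℚₚ.<⇒≤ (gap>0 x<y)) refl)) (separated x<y))

fromℚ-cancel : ∀ {p q} → fromℚ p ≤ fromℚ q → p ℚ.≤ q
fromℚ-cancel {p} {q} h = ℚₚ.≮⇒≥ λ q<p →
  let 0<δ = half-pos (gap-pos q<p) ; (N , hN) = below h (½ ℚ.* (p ℚ.- q)) 0<δ
  in ℚₚ.<-irrefl refl (ℚₚ.<-≤-trans 0<δ (cert-ℚ _ (Q.diff-nonneg (hN N ℕₚ.≤-refl))
       (solve 2 (λ p q → con 0ℚ := con ½ :* (p :- q) :+ (q :+ con ½ :* (p :- q) :- p)) refl p q)))

-- The order on ℝ is not decidable, so the alternatives overlap. One approximation with error at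
-- most half of `q - p` is compared with the midpoint of `p` and `q`.
approx-split : ∀ {p q} → p ℚ.< q → ∀ x → fromℚ p ≤ x ⊎ x ≤ fromℚ q
approx-split {p} {q} p<q x with cauchy x (½ ℚ.* (q ℚ.- p)) (half-pos (gap-pos p<q))
... | N , hN with ℚₚ.≤-total (½ ℚ.* (p ℚ.+ q)) (seq x N)
... | inj₁ mid≤ = inj₁ (≤-eventual (N , λ n le → cert-ℚ _
        (Q.+-nonneg (Q.diff-nonneg mid≤)
          (Q.diff-nonneg (ℚₚ.≤-trans (Q.p≤∣p∣ _) (hN N n ℕₚ.≤-refl le))))
        (solve 4 (λ p q a b → b := p :+ ((a :- con ½ :* (p :+ q)) :+ (con ½ :* (q :- p) :- (a :- b)))) refl p q (seq x N) (seq x n))))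
... | inj₂ ≤mid = inj₂ (≤-eventual (N , λ n le → cert-ℚ _
        (Q.+-nonneg (Q.diff-nonneg ≤mid)
          (Q.diff-nonneg (ℚₚ.≤-trans (Q.p≤∣p∣ _) (hN n N le ℕₚ.≤-refl))))
        (solve 4 (λ p q a b → q := b :+ ((con ½ :* (p :+ q) :- a) :+ (con ½ :* (q :- p) :- (b :- a)))) refl p q (seq x N) (seq x n))))

¼ : ℚ
¼ = ½ ℚ.* ½

2ℚ 4ℚ 7ℚ 64ℚ 1024ℚ : ℚ
2ℚ = 1ℚ ℚ.+ 1ℚ
4ℚ = 2ℚ ℚ.+ 2ℚ
7ℚ = 4ℚ ℚ.+ 2ℚ ℚ.+ 1ℚ
64ℚ = 4ℚ ℚ.* 4ℚ ℚ.* 4ℚ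
1024ℚ = 4ℚ ℚ.* 4ℚ ℚ.* 64ℚ

≃-trans : ∀ {x y z} → x ≃ y → y ≃ z → x ≃ z
≃-trans {x} {y} {z} x≃y y≃z = mk≃ λ δ 0<δ → ev-zip (λ n p q → subst₂ ℚ._≤_
      (cong ℚ.∣_∣ (solve 3 (λ x y z → (x :- y) :+ (y :- z) := x :- z) refl (seq x n) (seq y n) (seq z n)))
      (solve 1 (λ δ → con ½ :* δ :+ con ½ :* δ := δ) refl δ)
      (Q.∣-∣-mono-+ {seq x n ℚ.- seq y n} p q))
    (close x≃y (½ ℚ.* δ) (half-pos 0<δ)) (close y≃z (½ ℚ.* δ) (half-pos 0<δ))

eventually-above : ∀ {q r x} → fromℚ q ≤ x → r ℚ.< q → Eventually (λ n → r ℚ.≤ seq x n)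
eventually-above {q} {r} {x} q≤x r<q = ev-map (λ n h → cert-ℚ _ (Q.diff-nonneg h)
    (solve 3 (λ q r x → x := r :+ (x :+ (q :- r) :- q)) refl q r (seq x n)))
  (below q≤x (q ℚ.- r) (gap-pos r<q))

fromℚ≤⇒pos : ∀ {q x} → 0ℚ ℚ.< q → fromℚ q ≤ x → 0ℝ < x
fromℚ≤⇒pos {q} 0<q q≤x = mk< (½ ℚ.* q) (half-pos 0<q)
  (ev-map (λ n → subst (ℚ._≤ _) (sym (ℚₚ.+-identityˡ (½ ℚ.* q))))
    (eventually-above q≤x (subst (½ ℚ.* q ℚ.<_)
      (solve 1 (λ q → con ½ :* q :+ con ½ :* q := q) refl q)
      (subst (ℚ._< ½ ℚ.* q ℚ.+ ½ ℚ.* q) (ℚₚ.+-identityʳ (½ ℚ.* q))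
        (ℚₚ.+-monoʳ-< (½ ℚ.* q) (half-pos 0<q))))))

eventually-gap : ∀ {x} (x>0 : 0ℝ < x) → Eventually (λ n → gap x>0 ℚ.≤ seq x n)
eventually-gap {x} x>0 = ev-map (λ n → subst (ℚ._≤ seq x n) (ℚₚ.+-identityˡ (gap x>0))) (separated x>0)

*-inv : ∀ x x>0 → x * inv x x>0 ≃ 1ℝ
*-inv x x>0 = ≃-eventual (ev-map (λ n → Q.clampRecip-inv (gap>0 x>0) (seq x n)) (eventually-gap x>0))

inv-nonneg : ∀ x x>0 → 0ℝ ≤ inv x x>0
inv-nonneg x x>0 = ≤-pointwise λ n → ℚₚ.<⇒≤ (Q.clampRecip-pos (gap>0 x>0) (seq x n))

-- Bounds on absolute values

record Within (r : ℚ) (z : ℝ) : Set where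
  constructor within
  field
    lower : 0ℝ ≤ fromℚ r + z
    upper : 0ℝ ≤ fromℚ r - z

open Within

within-≃ : ∀ {r y z} → y ≃ z → Within r y → Within r z
within-≃ {r} {y} {z} y≃z h = within
  (≤-trans (lower h) (≤-cert (z - y) (diff-nonneg (≃⇒≤ y≃z)) λ n →
    solve 3 (λ r y z → r :+ z := r :+ y :+ (z :- y)) refl r (seq y n) (seq z n)))
  (≤-trans (upper h) (≤-cert (y - z) (diff-nonneg (≃⇒≤ (≃-sym y≃z))) λ n →
    solve 3 (λ r y z → r :- z := r :- y :+ (y :- z)) refl r (seq y n) (seq z n)))

within-mono : ∀ {r r′ z} → r ℚ.≤ r′ → Within r z → Within r′ z
within-mono {r} {r′} {z} r≤r′ h = within
  (≤-cert₂ (fromℚ (r′ ℚ.- r)) _ d (lower h) λ n →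
    solve 3 (λ r r′ z → r′ :+ z := con 0ℚ :+ (r′ :- r :+ (r :+ z))) refl r r′ (seq z n))
  (≤-cert₂ (fromℚ (r′ ℚ.- r)) _ d (upper h) λ n →
    solve 3 (λ r r′ z → r′ :- z := con 0ℚ :+ (r′ :- r :+ (r :- z))) refl r r′ (seq z n))
  where d = fromℚ-mono (Q.diff-nonneg r≤r′)

within-neg : ∀ {r z} → Within r z → Within r (- z)
within-neg {r} {z} h = within (upper h) (≤-trans (lower h) (≤-pointwise λ n →
  ℚₚ.≤-reflexive (solve 2 (λ r z → r :+ z := r :- :- z) refl r (seq z n))))

within-+ : ∀ {q r y z} → Within q y → Within r z → Within (q ℚ.+ r) (y + z)
within-+ {q} {r} {y} {z} g h = within
  (≤-cert₂ _ _ (lower g) (lower h) λ n →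
    solve 4 (λ q r y z → q :+ r :+ (y :+ z) := con 0ℚ :+ (q :+ y :+ (r :+ z))) refl q r (seq y n) (seq z n))
  (≤-cert₂ _ _ (upper g) (upper h) λ n →
    solve 4 (λ q r y z → q :+ r :- (y :+ z) := con 0ℚ :+ (q :- y :+ (r :- z))) refl q r (seq y n) (seq z n))

-- The mean of `(q + y) * (r + z)` and `(q - y) * (r - z)` is `q * r + y * z`, and pairing opposite
-- signs gives `q * r - y * z`. So the sign conditions of `Within` multiply without a case
-- distinction.
within-* : ∀ {q r y z} → Within q y → Within r z → Within (q ℚ.* r) (y * z)
within-* {q} {r} {y} {z} g h = within
  (≤-cert (fromℚ ½ * ((fromℚ q + y) * (fromℚ r + z) + (fromℚ q - y) * (fromℚ r - z)))
    (*-nonneg (fromℚ-mono 0≤½) (+-nonneg (*-nonneg (lower g) (lower h)) (*-nonneg (upper g) (upper h)))) λ n →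
    solve 4 (λ q r y z → q :* r :+ y :* z :=
      con 0ℚ :+ con ½ :* ((q :+ y) :* (r :+ z) :+ (q :- y) :* (r :- z))) refl q r (seq y n) (seq z n))
  (≤-cert (fromℚ ½ * ((fromℚ q + y) * (fromℚ r - z) + (fromℚ q - y) * (fromℚ r + z)))
    (*-nonneg (fromℚ-mono 0≤½) (+-nonneg (*-nonneg (lower g) (upper h)) (*-nonneg (upper g) (lower h)))) λ n →
    solve 4 (λ q r y z → q :* r :- y :* z :=
      con 0ℚ :+ con ½ :* ((q :+ y) :* (r :- z) :+ (q :- y) :* (r :+ z))) refl q r (seq y n) (seq z n))

between⇒within : ∀ {r z} → 0ℚ ℚ.≤ r → 0ℝ ≤ z → z ≤ fromℚ r → Within r z
between⇒within {r} {z} 0≤r 0≤z z≤r = within (+-nonneg (fromℚ-mono 0≤r) 0≤z) (diff-nonneg z≤r)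

-- No square root is taken: `2 * (1 ± u)` is `(1 ± u)² + v² + (1 - u² - v²)`, whose last term
-- vanishes.
within-unit : ∀ {u v} → u * u + v * v ≃ 1ℝ → Within 1ℚ u
within-unit {u} {v} unit = within
  (≤-cert (fromℚ ½ * ((1ℝ + u) * (1ℝ + u) + v * v + (1ℝ - (u * u + v * v))))
    (*-nonneg (fromℚ-mono 0≤½) (+-nonneg (+-nonneg (square-nonneg _) (square-nonneg v)) rest)) λ n →
    solve 2 (λ u v → con 1ℚ :+ u := con 0ℚ :+ con ½ :* ((con 1ℚ :+ u) :* (con 1ℚ :+ u) :+ v :* v
      :+ (con 1ℚ :- (u :* u :+ v :* v)))) refl (seq u n) (seq v n))
  (≤-cert (fromℚ ½ * ((1ℝ - u) * (1ℝ - u) + v * v + (1ℝ - (u * u + v * v))))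
    (*-nonneg (fromℚ-mono 0≤½) (+-nonneg (+-nonneg (square-nonneg _) (square-nonneg v)) rest)) λ n →
    solve 2 (λ u v → con 1ℚ :- u := con 0ℚ :+ con ½ :* ((con 1ℚ :- u) :* (con 1ℚ :- u) :+ v :* v
      :+ (con 1ℚ :- (u :* u :+ v :* v)))) refl (seq u n) (seq v n))
  where rest = diff-nonneg (≃⇒≤ unit)

unit-swap : ∀ {u v} → u * u + v * v ≃ 1ℝ → v * v + u * u ≃ 1ℝ
unit-swap {u} {v} = ≃-trans (≃-pointwise λ n → ℚₚ.+-comm (seq v n ℚ.* seq v n) (seq u n ℚ.* seq u n))

unit-neg : ∀ {u v} → u * u + v * v ≃ 1ℝ → u * u + - v * - v ≃ 1ℝ
unit-neg {u} {v} = ≃-trans (≃-pointwise λ n →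
  solve 2 (λ u v → u :* u :+ :- v :* :- v := u :* u :+ v :* v) refl (seq u n) (seq v n))

-- One of the squares is at least 1/2, but which one cannot be decided; the lower threshold 1/4,
-- that is a cosine of 1/2, makes room for `approx-split`.
unit-split : ∀ {u v} → u * u + v * v ≃ 1ℝ → fromℚ ¼ ≤ u * u ⊎ fromℚ ¼ ≤ v * v
unit-split {u} {v} unit = Sum.map₂ other (approx-split (from-yes (¼ ℚₚ.<? ½)) (u * u))
  where
  other : u * u ≤ fromℚ ½ → fromℚ ¼ ≤ v * v
  other h = ≤-cert _ (+-nonneg (fromℚ-mono (Q.*-nonneg 0≤½ 0≤½))
      (+-nonneg (diff-nonneg h) (diff-nonneg (≃⇒≤ (≃-sym unit))))) λ n →
    solve 2 (λ u v → v :* v := con ¼ :+ (con (½ ℚ.* ½) :+ (con ½ :- u :* u :+ (u :* u :+ v :* v :- con 1ℚ)))) refl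
      (seq u n) (seq v n)

inv-within : ∀ {z} (z>0 : 0ℝ < z) → fromℚ ¼ ≤ z → Within 4ℚ (inv z z>0)
inv-within {z} z>0 ¼≤z = between⇒within (from-yes (0ℚ ℚₚ.≤? 4ℚ)) (inv-nonneg z z>0)
  (≤-cert₂ (fromℚ 4ℚ * ((z - fromℚ ¼) * inv z z>0)) (fromℚ 4ℚ * (1ℝ - z * inv z z>0))
    (*-nonneg (fromℚ-mono (from-yes (0ℚ ℚₚ.≤? 4ℚ))) (*-nonneg (diff-nonneg ¼≤z) (inv-nonneg z z>0)))
    (*-nonneg (fromℚ-mono (from-yes (0ℚ ℚₚ.≤? 4ℚ))) (diff-nonneg (≃⇒≤ (*-inv z z>0)))) λ n →
    solve 2 (λ z i → con 4ℚ := i :+ (con 4ℚ :* ((z :- con ¼) :* i) :+ con 4ℚ :* (con 1ℚ :- z :* i))) refl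
      (seq z n) (seq (inv z z>0) n))

-- Dyadic scales

dy : ℕ → ℚ
dy k = ½ ^ k

dy-pos : ∀ k → 0ℚ ℚ.< dy k
dy-pos zero    = Q.0<1
dy-pos (suc k) = half-pos (dy-pos k)

dy-nonneg : ∀ k → 0ℚ ℚ.≤ dy k
dy-nonneg k = ℚₚ.<⇒≤ (dy-pos k)

dy-+ : ∀ j k → dy (j ℕ.+ k) ≡ dy j ℚ.* dy k
dy-+ zero    k = sym (ℚₚ.*-identityˡ (dy k))
dy-+ (suc j) k = trans (cong (½ ℚ.*_) (dy-+ j k)) (sym (ℚₚ.*-assoc ½ (dy j) (dy k)))

dy-anti-+ : ∀ k d → dy (d ℕ.+ k) ℚ.≤ dy k
dy-anti-+ k zero    = ℚₚ.≤-refl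
dy-anti-+ k (suc d) = ℚₚ.≤-trans (cert-ℚ _ (ℚₚ.<⇒≤ (half-pos (dy-pos (d ℕ.+ k))))
  (solve 1 (λ a → a := con ½ :* a :+ con ½ :* a) refl (dy (d ℕ.+ k)))) (dy-anti-+ k d)

dy-anti : ∀ {k l} → k ℕ.≤ l → dy l ℚ.≤ dy k
dy-anti {k} {l} k≤l = subst (λ m → dy m ℚ.≤ dy k) (ℕₚ.m∸n+n≡m k≤l) (dy-anti-+ k (l ℕ.∸ k))

dy-cancel : ∀ {k l} → dy l ℚ.≤ dy k → k ℕ.≤ l
dy-cancel {k} {l} h = ℕₚ.≮⇒≥ λ l<k → ℚₚ.<-irrefl refl (ℚₚ.<-≤-trans (half-pos (dy-pos l))
  (cert-ℚ _ (Q.diff-nonneg (ℚₚ.≤-trans h (dy-anti l<k)))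
    (solve 1 (λ a → con 0ℚ := con ½ :* a :+ (con ½ :* a :- a)) refl (dy l))))

fromℕ-+ : ∀ m n → Q.fromℕ (m ℕ.+ n) ≡ Q.fromℕ m ℚ.+ Q.fromℕ n
fromℕ-+ zero    n = sym (ℚₚ.+-identityˡ (Q.fromℕ n))
fromℕ-+ (suc m) n = trans (cong (1ℚ ℚ.+_) (fromℕ-+ m n)) (sym (ℚₚ.+-assoc 1ℚ (Q.fromℕ m) (Q.fromℕ n)))

fromℕ-* : ∀ m n → Q.fromℕ (m ℕ.* n) ≡ Q.fromℕ m ℚ.* Q.fromℕ n
fromℕ-* zero    n = sym (ℚₚ.*-zeroˡ (Q.fromℕ n))
fromℕ-* (suc m) n = trans (fromℕ-+ n (m ℕ.* n)) (trans (cong (Q.fromℕ n ℚ.+_) (fromℕ-* m n))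
  (solve 2 (λ m n → n :+ m :* n := (con 1ℚ :+ m) :* n) refl (Q.fromℕ m) (Q.fromℕ n)))

fromℕ-mono : ∀ {m n} → m ℕ.≤ n → Q.fromℕ m ℚ.≤ Q.fromℕ n
fromℕ-mono {m} {n} m≤n = subst (λ k → Q.fromℕ m ℚ.≤ Q.fromℕ k) (ℕₚ.m+[n∸m]≡n m≤n)
  (cert-ℚ _ (Q.fromℕ-nonneg (n ℕ.∸ m)) (fromℕ-+ m (n ℕ.∸ m)))

2^-dy : ∀ k → Q.fromℕ (2 ℕ.^ k) ℚ.* dy k ≡ 1ℚ
2^-dy zero    = refl
2^-dy (suc k) = trans (cong (ℚ._* dy (suc k)) (fromℕ-* 2 (2 ℕ.^ k)))
  (trans (solve 2 (λ a b → con 2ℚ :* a :* (con ½ :* b) := a :* b) refl (Q.fromℕ (2 ℕ.^ k)) (dy k)) (2^-dy k))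

-- The search descends from the top. As `s` can be compared with `n * h` and `(n + 1) * h` only
-- approximately, the error is `2 * h` rather than `h`.
locate-suc : ∀ {h s} → 0ℚ ℚ.< h → 0ℝ ≤ s → ∀ n → s ≤ fromℚ (Q.fromℕ (suc n) ℚ.* h) →
  ∃[ i ] i ℕ.< suc n × Within (2ℚ ℚ.* h) (s - fromℚ (Q.fromℕ i ℚ.* h))
locate-suc {h} {s} 0<h 0≤s zero s≤ = 0 , ℕ.s≤s ℕ.z≤n , within
  (≤-cert₂ s (fromℚ (2ℚ ℚ.* h)) 0≤s 0≤2h λ n →
    solve 2 (λ h s → con 2ℚ :* h :+ (s :- con 0ℚ :* h) := con 0ℚ :+ (s :+ con 2ℚ :* h)) refl h (seq s n))
  (≤-cert₂ _ (fromℚ h) (diff-nonneg s≤) (fromℚ-mono (ℚₚ.<⇒≤ 0<h)) λ n →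
    solve 2 (λ h s → con 2ℚ :* h :- (s :- con 0ℚ :* h) := con 0ℚ :+ ((con 1ℚ :+ con 0ℚ) :* h :- s :+ h)) refl h (seq s n))
  where 0≤2h = fromℚ-mono (Q.*-nonneg (from-yes (0ℚ ℚₚ.≤? 2ℚ)) (ℚₚ.<⇒≤ 0<h))
locate-suc {h} {s} 0<h 0≤s (suc n) s≤ = Sum.[ found , smaller ]′ (approx-split step s)
  where
  step : Q.fromℕ n ℚ.* h ℚ.< Q.fromℕ (suc n) ℚ.* h
  step = subst₂ ℚ._<_ (ℚₚ.+-identityˡ (Q.fromℕ n ℚ.* h))
    (solve 2 (λ n h → h :+ n :* h := (con 1ℚ :+ n) :* h) refl (Q.fromℕ n) h)
    (ℚₚ.+-monoˡ-< (Q.fromℕ n ℚ.* h) 0<h)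
  found : fromℚ (Q.fromℕ n ℚ.* h) ≤ s → _
  found ≤s = n , ℕₚ.m≤n⇒m≤1+n ℕₚ.≤-refl , between⇒within
    (Q.*-nonneg (from-yes (0ℚ ℚₚ.≤? 2ℚ)) (ℚₚ.<⇒≤ 0<h)) (diff-nonneg ≤s)
    (≤-cert (fromℚ (Q.fromℕ (suc (suc n)) ℚ.* h) - s) (diff-nonneg s≤) λ k →
      solve 3 (λ n h s → con 2ℚ :* h :=
        s :- n :* h :+ ((con 1ℚ :+ (con 1ℚ :+ n)) :* h :- s)) refl (Q.fromℕ n) h (seq s k))
  smaller : s ≤ fromℚ (Q.fromℕ (suc n) ℚ.* h) → _
  smaller s≤′ = let (i , i< , w) = locate-suc 0<h 0≤s n s≤′ in i , ℕₚ.m≤n⇒m≤1+n i< , w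

locate : ∀ {h s} → 0ℚ ℚ.< h → 0ℝ ≤ s → ∀ n .{{_ : ℕ.NonZero n}} → s ≤ fromℚ (Q.fromℕ n ℚ.* h) →
  ∃[ i ] i ℕ.< n × Within (2ℚ ℚ.* h) (s - fromℚ (Q.fromℕ i ℚ.* h))
locate 0<h 0≤s (suc n) s≤ = locate-suc 0<h 0≤s n s≤

-- `K` is the fuel; when it runs out, the lower bound on `x` is the answer. Otherwise either
-- `x ≥ 2⁻ʲ` and the search stops, or `x ≤ 2 * 2⁻ʲ = 4 * 2⁻⁽ʲ⁺¹⁾` and it goes on; the overlap
-- accounts for the factor 4.
dyadic-scale : ∀ {x} K j → fromℚ (dy (K ℕ.+ j)) ≤ x → x ≤ fromℚ (4ℚ ℚ.* dy j) →
  ∃[ l ] fromℚ (dy l) ≤ x × x ≤ fromℚ (4ℚ ℚ.* dy l)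
dyadic-scale zero j ≤x x≤ = j , ≤x , x≤
dyadic-scale {x} (suc K) j ≤x x≤ = Sum.[ (λ h → j , h , x≤) , smaller ]′ (approx-split dy< x)
  where
  dy< : dy j ℚ.< 2ℚ ℚ.* dy j
  dy< = subst₂ ℚ._<_ (ℚₚ.+-identityˡ (dy j)) (solve 1 (λ d → d :+ d := con 2ℚ :* d) refl (dy j))
    (ℚₚ.+-monoˡ-< (dy j) (dy-pos j))
  smaller : x ≤ fromℚ (2ℚ ℚ.* dy j) → _
  smaller h = dyadic-scale K (suc j) (subst (λ m → fromℚ (dy m) ≤ x) (sym (ℕₚ.+-suc K j)) ≤x)
    (≤-trans h (fromℚ-mono (ℚₚ.≤-reflexive (solve 1 (λ d → con 2ℚ :* d := con 4ℚ :* (con ½ :* d)) refl (dy j)))))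

dy-small : ∀ {q} → 0ℚ ℚ.< q → ∃[ k ] dy k ℚ.≤ q
dy-small {q} 0<q = Q.q^-small (from-yes (0ℚ ℚₚ.<? ½)) 0≤½ q 0<q

dyadic-scale-pos : ∀ {x} → 0ℝ < x → x ≤ fromℚ 4ℚ → ∃[ l ] fromℚ (dy l) ≤ x × x ≤ fromℚ (4ℚ ℚ.* dy l)
dyadic-scale-pos {x} x>0 x≤4 =
  -- The positivity witness supplies the fuel.
  let (K , h) = dy-small (gap>0 x>0) in
  dyadic-scale K 0 (≤-eventual (ev-map (λ n → ℚₚ.≤-trans
      (subst (λ m → dy m ℚ.≤ gap x>0) (sym (ℕₚ.+-identityʳ K)) h)) (eventually-gap x>0))) x≤4

-- Boxes in centred coordinates

form : (X Y u v x y : ℝ) → ℝ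
form X Y u v x y = (x - X) * u + (y - Y) * v

-- Membership of (x , y) in the box with centre (X , Y) and half-lengths α and β in the directions
-- (u , v) and (- v , u).
record InBox (X Y u v : ℝ) (α β : ℚ) (x y : ℝ) : Set where
  constructor inBox
  field
    along  : Within α (form X Y u v x y)
    across : Within β (form X Y (- v) u x y)

module _ {X Y u v : ℝ} {α β : ℚ} {x y : ℝ} where

  -- Reflection in the diagonal reverses the orientation, hence the sign change in the second
  -- coordinate.
  inBox-transpose : InBox X Y u v α β x y → InBox Y X v u α β y x
  inBox-transpose (inBox s t) = inBox
    (within-≃ (≃-pointwise λ n → solve 4 (λ a b u v → a :* u :+ b :* v := b :* v :+ a :* u) refl
      (seq (x - X) n) (seq (y - Y) n) (seq u n) (seq v n)) s)
    (within-≃ (≃-pointwise λ n → solve 4 (λ a b u v → :- (a :* :- v :+ b :* u) := b :* :- u :+ a :* v) refl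
      (seq (x - X) n) (seq (y - Y) n) (seq u n) (seq v n)) (within-neg t))

  -- A quarter turn sends `(u , v)` to `(- v , u)` and `(- v , u)` to `(- u , - v)`: the
  -- half-lengths trade places and one coordinate changes sign.
  inBox-unrotate : InBox X Y (- v) u β α x y → InBox X Y u v α β x y
  inBox-unrotate (inBox t s) = inBox
    (within-≃ (≃-pointwise λ n → solve 4 (λ a b u v → :- (a :* :- u :+ b :* :- v) := a :* u :+ b :* v) refl
      (seq (x - X) n) (seq (y - Y) n) (seq u n) (seq v n)) (within-neg s)) t

-- The net

grid : ℕ → ℕ → ℚ
grid k i = Q.fromℕ i ℚ.* dy k ℚ.- ½

record NetPoint (M : ℕ) (p q : ℚ) : Set where
  constructor netPoint
  field
    {k j i i′} : ℕ
    k+j≡M      : k ℕ.+ j ≡ M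
    i<         : i ℕ.< 2 ℕ.^ k
    i′<        : i′ ℕ.< 2 ℕ.^ j
    p≡         : p ≡ grid k i
    q≡         : q ≡ grid j i′

transpose : ∀ {M p q} → NetPoint M p q → NetPoint M q p
transpose (netPoint {k} {j} e i< i′< p≡ q≡) = netPoint {k = j} {k} (trans (ℕₚ.+-comm j k) e) i′< i< q≡ p≡

locate-grid : ∀ k {z} → ℐ z → ∃[ i ] i ℕ.< 2 ℕ.^ k × Within (2ℚ ℚ.* dy k) (z - fromℚ (grid k i))
locate-grid k {z} (-½≤z , z≤½) =
  let (i , i< , w) = locate {dy k} {z + fromℚ ½} (dy-pos k)
        (≤-trans (diff-nonneg -½≤z) (≤-pointwise λ n → ℚₚ.≤-reflexive
          (solve 1 (λ z → z :- con (ℚ.- ½) := z :+ con ½) refl (seq z n))))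
        (2 ℕ.^ k) {{ℕₚ.m^n≢0 2 k}}
        (≤-cert _ (diff-nonneg z≤½) λ n → trans (2^-dy k)
          (solve 1 (λ z → con 1ℚ := z :+ con ½ :+ (con ½ :- z)) refl (seq z n)))
  in i , i< , within-≃ (≃-pointwise λ n → solve 2 (λ z a → z :+ con ½ :- a := z :- (a :- con ½)) refl
       (seq z n) (Q.fromℕ i ℚ.* dy k)) w

-- Boxes whose long axis is at most 60° from the horizontal

module NonVerticalAxis {X Y u v : ℝ} {l k M : ℕ} (l≤k : l ℕ.≤ k) (size : 8 ℕ.+ (l ℕ.+ k) ℕ.≤ M)
  (unit : u * u + v * v ≃ 1ℝ) (¼≤u² : fromℚ ¼ ≤ u * u)
  (inside : ∀ x y → InBox X Y u v (½ ℚ.* dy l) (½ ℚ.* dy k) x y → ℐ² (x , y)) where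

  private
    α β : ℚ
    α = ½ ℚ.* dy l
    β = ½ ℚ.* dy k

    0≤α : 0ℚ ℚ.≤ α
    0≤α = ℚₚ.<⇒≤ (half-pos (dy-pos l))

    0≤β : 0ℚ ℚ.≤ β
    0≤β = ℚₚ.<⇒≤ (half-pos (dy-pos k))

    u²>0 : 0ℝ < u * u
    u²>0 = fromℚ≤⇒pos (from-yes (0ℚ ℚₚ.<? ¼)) ¼≤u²

    -- `w` is 1/u, formed from the inverse of `u * u` because `inv` takes a positive argument and
    -- the sign of `u` is unknown.
    ι w : ℝ
    ι = inv (u * u) u²>0
    w = u * ι

    |w|≤4 : Within (1ℚ ℚ.* 4ℚ) w
    |w|≤4 = within-* (within-unit unit) (inv-within u²>0 ¼≤u²)

    |v|≤1 : Within 1ℚ v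
    |v|≤1 = within-unit (unit-swap unit)

    zero-within : ∀ {r z} → 0ℚ ℚ.≤ r → (∀ n → 0ℚ ≡ seq z n) → Within r z
    zero-within {r} 0≤r eq = within-≃ (≃-pointwise eq) (between⇒within {z = 0ℝ} 0≤r ≤-refl (fromℚ-mono 0≤r))

    centre : ℐ² (X , Y)
    centre = inside X Y (inBox
      (zero-within 0≤α (λ n → solve 4 (λ X Y u v → con 0ℚ := (X :- X) :* u :+ (Y :- Y) :* v) refl
          (seq X n) (seq Y n) (seq u n) (seq v n)))
      (zero-within 0≤β (λ n → solve 4 (λ X Y u v → con 0ℚ := (X :- X) :* :- v :+ (Y :- Y) :* u) refl
          (seq X n) (seq Y n) (seq u n) (seq v n))))

    module Column (i : ℕ) (near : Within (2ℚ ℚ.* dy (5 ℕ.+ l)) (X - fromℚ (grid (5 ℕ.+ l) i))) where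

      x d Y′ : ℝ
      x  = fromℚ (grid (5 ℕ.+ l) i)
      d  = x - X
      -- (x , Y′) lies on the axis through the centre in direction (u , v).
      Y′ = Y + d * (v * w)

      -- As `w` is 1/u, the form equals `d * (u + v² * w) = d * w * (u² + v²) = d * w`. Level `5 +
      -- l` makes `2 * 2⁻⁽⁵⁺ˡ⁾ * 4` equal to `½ * α`; the other half of `α` is left for the vertical
      -- move to a grid point.
      along : Within (½ ℚ.* α) (form X Y u v x Y′)
      along = within-≃ (≃-trans {y = d * (w * (u * u + v * v))} eq₁ eq₂)
        (within-mono (ℚₚ.≤-reflexive
          (solve 1 (λ a → (con 2ℚ :* (con ½ :* (con ½ :* (con ½ :* (con ½ :* (con ½ :* a)))))) :* (con 1ℚ :* con 4ℚ)
            := con ½ :* (con ½ :* a)) refl (dy l)))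
          (within-≃ (≃-pointwise λ n → solve 3 (λ x X w → :- (X :- x) :* w := (x :- X) :* w) refl
              (seq x n) (seq X n) (seq w n))
            (within-* (within-neg near) |w|≤4)))
        where
        eq₁ : d * w ≃ d * (w * (u * u + v * v))
        eq₁ = ≃-modulo {z = 1ℝ} {w = u * u + v * v} (d * w) (≃-sym unit) λ n →
          solve 3 (λ d w s → d :* w := d :* (w :* s) :+ (d :* w) :* (con 1ℚ :- s)) refl
            (seq d n) (seq w n) (seq (u * u + v * v) n)
        eq₂ : d * (w * (u * u + v * v)) ≃ form X Y u v x Y′
        eq₂ = ≃-modulo {z = u * u * ι} {w = 1ℝ} (d * u) (*-inv (u * u) u²>0) λ n →
          solve 6 (λ x X Y u v ι → let d = x :- X ; w = u :* ι in
              d :* (w :* (u :* u :+ v :* v)) :=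
              d :* u :+ (Y :+ d :* (v :* w) :- Y) :* v :+ (d :* u) :* (u :* u :* ι :- con 1ℚ)) refl
            (seq x n) (seq X n) (seq Y n) (seq u n) (seq v n) (seq ι n)

      across : Within 0ℚ (form X Y (- v) u x Y′)
      across = within-≃ (≃-modulo {x = 0ℝ} {z = 1ℝ} {w = u * u * ι} (d * v) (≃-sym (*-inv (u * u) u²>0)) λ n →
          solve 6 (λ x X Y u v ι → let d = x :- X ; w = u :* ι in
              con 0ℚ := d :* :- v :+ (Y :+ d :* (v :* w) :- Y) :* u :+ (d :* v) :* (con 1ℚ :- u :* u :* ι)) refl
            (seq x n) (seq X n) (seq Y n) (seq u n) (seq v n) (seq ι n))
        (zero-within ℚₚ.≤-refl λ _ → refl)

      -- This is what `locate-grid` asks of the height `Y′`: the axis point belongs to the box,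
      -- hence to the square.
      on-axis : ℐ Y′
      on-axis = proj₂ (inside x Y′ (inBox
        (within-mono (cert-ℚ _ (Q.*-nonneg 0≤½ 0≤α) (solve 1 (λ a → a := con ½ :* a :+ con ½ :* a) refl α)) along)
        (within-mono 0≤β across)))

      hits : ∀ j i′ → 3 ℕ.+ k ℕ.≤ j → Within (2ℚ ℚ.* dy j) (Y′ - fromℚ (grid j i′)) →
        InBox X Y u v α β x (fromℚ (grid j i′))
      hits j i′ k≤j near′ = inBox
        (within-≃ (≃-pointwise λ n → solve 7 (λ x X Y Y′ y u v →
            (x :- X) :* u :+ (Y′ :- Y) :* v :+ :- ((Y′ :- y) :* v) := (x :- X) :* u :+ (y :- Y) :* v) refl
            (seq x n) (seq X n) (seq Y n) (seq Y′ n) (grid j i′) (seq u n) (seq v n))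
          (within-mono bound₁ (within-+ along (within-neg (within-* near′ |v|≤1)))))
        (within-≃ (≃-pointwise λ n → solve 7 (λ x X Y Y′ y u v →
            (x :- X) :* :- v :+ (Y′ :- Y) :* u :+ :- ((Y′ :- y) :* u) := (x :- X) :* :- v :+ (y :- Y) :* u) refl
            (seq x n) (seq X n) (seq Y n) (seq Y′ n) (grid j i′) (seq u n) (seq v n))
          (within-mono bound₂ (within-+ across (within-neg (within-* near′ (within-unit unit))))))
        where
        -- The vertical move is at most `2 * 2⁻⁽³⁺ᵏ⁾ = ¼ * dy k`, which `l ≤ k` bounds by
        -- `¼ * dy l = ½ * α`.
        bound₁ : ½ ℚ.* α ℚ.+ 2ℚ ℚ.* dy j ℚ.* 1ℚ ℚ.≤ α
        bound₁ = cert-ℚ (2ℚ ℚ.* (dy (3 ℕ.+ k) ℚ.- dy j) ℚ.+ ¼ ℚ.* (dy l ℚ.- dy k))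
          (Q.+-nonneg (Q.*-nonneg (from-yes (0ℚ ℚₚ.≤? 2ℚ)) (Q.diff-nonneg (dy-anti k≤j)))
            (Q.*-nonneg (from-yes (0ℚ ℚₚ.≤? ¼)) (Q.diff-nonneg (dy-anti l≤k))))
          (solve 3 (λ a b c → con ½ :* a := con ½ :* (con ½ :* a) :+ con 2ℚ :* c :* con 1ℚ :+
            (con 2ℚ :* (con ½ :* (con ½ :* (con ½ :* b)) :- c) :+ con ¼ :* (a :- b))) refl (dy l) (dy k) (dy j))
        bound₂ : 0ℚ ℚ.+ 2ℚ ℚ.* dy j ℚ.* 1ℚ ℚ.≤ β
        bound₂ = cert-ℚ (2ℚ ℚ.* (dy (3 ℕ.+ k) ℚ.- dy j) ℚ.+ ¼ ℚ.* dy k)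
          (Q.+-nonneg (Q.*-nonneg (from-yes (0ℚ ℚₚ.≤? 2ℚ)) (Q.diff-nonneg (dy-anti k≤j)))
            (Q.*-nonneg (from-yes (0ℚ ℚₚ.≤? ¼)) (dy-nonneg k)))
          (solve 2 (λ b c → con ½ :* b := con 0ℚ :+ con 2ℚ :* c :* con 1ℚ :+
            (con 2ℚ :* (con ½ :* (con ½ :* (con ½ :* b)) :- c) :+ con ¼ :* b)) refl (dy k) (dy j))

    j : ℕ
    j = M ℕ.∸ (5 ℕ.+ l)

    5+l≤M : 5 ℕ.+ l ℕ.≤ M
    5+l≤M = ℕₚ.≤-trans (ℕₚ.+-mono-≤ (ℕₚ.m≤m+n 5 3) (ℕₚ.m≤m+n l k)) size

    3+k≤j : 3 ℕ.+ k ℕ.≤ j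
    3+k≤j = ℕₚ.m+n≤o⇒m≤o∸n (3 ℕ.+ k) (subst (ℕ._≤ M) eq size)
      where
      eq : 8 ℕ.+ (l ℕ.+ k) ≡ 3 ℕ.+ k ℕ.+ (5 ℕ.+ l)
      eq = cong (3 ℕ.+_) (trans (cong (5 ℕ.+_) (ℕₚ.+-comm l k)) (trans (sym (ℕₚ.+-assoc 5 k l))
        (trans (cong (ℕ._+ l) (ℕₚ.+-comm 5 k)) (ℕₚ.+-assoc k 5 l))))

  -- The 8 levels in `size` are 5 for the columns, of level `5 + l`, and 3 for the rows, whose level
  -- `j = M ∸ (5 + l)` is then at least `3 + k`.
  hit : ∃[ p ] ∃[ q ] NetPoint M p q × InBox X Y u v (½ ℚ.* dy l) (½ ℚ.* dy k) (fromℚ p) (fromℚ q)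
  hit =
    let (i , i< , near) = locate-grid (5 ℕ.+ l) (proj₁ centre)
        open Column i near
        (i′ , i′< , near′) = locate-grid j on-axis
    in grid (5 ℕ.+ l) i , grid j i′ , netPoint {k = 5 ℕ.+ l} {j} (ℕₚ.m+[n∸m]≡n 5+l≤M) i< i′< refl refl , hits j i′ 3+k≤j near′

Hits : (X Y u v : ℝ) (α β : ℚ) → ℕ → Set
Hits X Y u v α β M = ∃[ p ] ∃[ q ] NetPoint M p q × InBox X Y u v α β (fromℚ p) (fromℚ q)

hit-long : ∀ {X Y u v l k M} → l ℕ.≤ k → 8 ℕ.+ (l ℕ.+ k) ℕ.≤ M → u * u + v * v ≃ 1ℝ →
  (∀ x y → InBox X Y u v (½ ℚ.* dy l) (½ ℚ.* dy k) x y → ℐ² (x , y)) →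
  Hits X Y u v (½ ℚ.* dy l) (½ ℚ.* dy k) M
hit-long {X} {Y} {u} {v} {l} {k} {M} l≤k size unit inside = Sum.[ direct , transposed ]′ (unit-split unit)
  where
  direct : fromℚ ¼ ≤ u * u → _
  direct h = NonVerticalAxis.hit {l = l} {k} l≤k size unit h inside
  transposed : fromℚ ¼ ≤ v * v → Hits X Y u v (½ ℚ.* dy l) (½ ℚ.* dy k) M
  transposed h =
    let (p , q , pt , b) = NonVerticalAxis.hit {Y} {X} {v} {u} {l} {k} l≤k size (unit-swap unit) h
          (λ y x b → swap (inside x y (inBox-transpose b)))
    in q , p , transpose pt , inBox-transpose b

-- If the second side is the longer one, a quarter turn of the frame brings it to the first place,
-- as `hit-long` requires.
hit-box : ∀ {X Y u v l k M} → 8 ℕ.+ (l ℕ.+ k) ℕ.≤ M → u * u + v * v ≃ 1ℝ →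
  (∀ x y → InBox X Y u v (½ ℚ.* dy l) (½ ℚ.* dy k) x y → ℐ² (x , y)) →
  Hits X Y u v (½ ℚ.* dy l) (½ ℚ.* dy k) M
hit-box {X} {Y} {u} {v} {l} {k} {M} size unit inside =
  Sum.[ (λ l≤k → hit-long {l = l} {k} l≤k size unit inside) , rotated ]′ (ℕₚ.≤-total l k)
  where
  rotated : k ℕ.≤ l → Hits X Y u v (½ ℚ.* dy l) (½ ℚ.* dy k) M
  rotated k≤l =
    let (p , q , pt , b) = hit-long {X} {Y} { - v} {u} {k} {l} k≤l
          (subst (λ m → 8 ℕ.+ m ℕ.≤ M) (ℕₚ.+-comm l k) size) (unit-swap (unit-neg unit))
          (λ x y b → inside x y (inBox-unrotate b))
    in p , q , pt , inBox-unrotate b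

-- The net as a list of points

cell : ℕ → ℕ → List ℝ²
cell k j = cartesianProduct (map (λ i → fromℚ (grid k i)) (upTo (2 ℕ.^ k)))
                            (map (λ i → fromℚ (grid j i)) (upTo (2 ℕ.^ j)))

-- The sum of the two levels is constant along the recursion, so `cells M 0` runs through all
-- splittings of `M`.
cells : ℕ → ℕ → List ℝ²
cells zero    j = cell zero j
cells (suc k) j = cell (suc k) j ++ cells k (suc j)

length-cartesianProduct : ∀ {A B : Set} (xs : List A) (ys : List B) →
  length (cartesianProduct xs ys) ≡ length xs ℕ.* length ys
length-cartesianProduct []       ys = refl
length-cartesianProduct (x ∷ xs) ys = trans (Listₚ.length-++ (map (x ,_) ys))
  (cong₂ ℕ._+_ (Listₚ.length-map (x ,_) ys) (length-cartesianProduct xs ys))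

length-cell : ∀ k j → length (cell k j) ≡ 2 ℕ.^ (k ℕ.+ j)
length-cell k j = trans (length-cartesianProduct (map (λ i → fromℚ (grid k i)) (upTo (2 ℕ.^ k))) _)
  (trans (cong₂ ℕ._*_ (len k) (len j)) (sym (ℕₚ.^-distribˡ-+-* 2 k j)))
  where
  len : ∀ k → length (map (λ i → fromℚ (grid k i)) (upTo (2 ℕ.^ k))) ≡ 2 ℕ.^ k
  len k = trans (Listₚ.length-map _ (upTo (2 ℕ.^ k))) (Listₚ.length-upTo (2 ℕ.^ k))

length-cells : ∀ k j → length (cells k j) ≡ suc k ℕ.* 2 ℕ.^ (k ℕ.+ j)
length-cells zero    j = trans (length-cell 0 j) (sym (ℕₚ.+-identityʳ (2 ℕ.^ j)))
length-cells (suc k) j = trans (Listₚ.length-++ (cell (suc k) j))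
  (cong₂ ℕ._+_ (length-cell (suc k) j)
    (trans (length-cells k (suc j)) (cong (λ m → suc k ℕ.* 2 ℕ.^ m) (ℕₚ.+-suc k j))))

∈-cells : ∀ d k j {p} → p ∈ cell k (d ℕ.+ j) → p ∈ cells (d ℕ.+ k) j
∈-cells zero    zero    j h = h
∈-cells zero    (suc k) j h = ∈ₚ.∈-++⁺ˡ h
∈-cells (suc d) k       j {p} h = ∈ₚ.∈-++⁺ʳ (cell (suc (d ℕ.+ k)) j)
  (∈-cells d k (suc j) (subst (λ m → p ∈ cell k m) (sym (ℕₚ.+-suc d j)) h))

grid-ℐ : ∀ k {i} → i ℕ.< 2 ℕ.^ k → ℐ (fromℚ (grid k i))
grid-ℐ k {i} i< =
  fromℚ-mono (cert-ℚ _ (Q.*-nonneg (Q.fromℕ-nonneg i) (dy-nonneg k))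
    (solve 1 (λ a → a :- con ½ := con (ℚ.- ½) :+ a) refl (Q.fromℕ i ℚ.* dy k))) ,
  fromℚ-mono (cert-ℚ _ (Q.diff-nonneg (subst (Q.fromℕ i ℚ.* dy k ℚ.≤_) (2^-dy k)
      (Q.*-mono (Q.fromℕ-nonneg i) (dy-nonneg k) (fromℕ-mono (ℕₚ.<⇒≤ i<)) ℚₚ.≤-refl)))
    (solve 1 (λ a → con ½ := a :- con ½ :+ (con 1ℚ :- a)) refl (Q.fromℕ i ℚ.* dy k)))

cell-⊆ : ∀ k j → All ℐ² (cell k j)
cell-⊆ k j = All.tabulate λ h →
  let (hx , hy) = ∈ₚ.∈-cartesianProduct⁻ (map (λ i → fromℚ (grid k i)) (upTo (2 ℕ.^ k))) _ h
  in side k hx , side j hy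
  where
  side : ∀ k {x} → x ∈ map (λ i → fromℚ (grid k i)) (upTo (2 ℕ.^ k)) → ℐ x
  side k h with ∈ₚ.∈-map⁻ (λ i → fromℚ (grid k i)) h
  ... | i , i∈ , refl = grid-ℐ k (∈ₚ.∈-upTo⁻ i∈)

cells-⊆ : ∀ k j → All ℐ² (cells k j)
cells-⊆ zero    j = cell-⊆ zero j
cells-⊆ (suc k) j = Allₚ.++⁺ (cell-⊆ (suc k) j) (cells-⊆ k (suc j))

abstract

  net : ℕ → List ℝ²
  net M = cells M 0

  length-net : ∀ M → length (net M) ≡ suc M ℕ.* 2 ℕ.^ M
  length-net M = trans (length-cells M 0) (cong (λ m → suc M ℕ.* 2 ℕ.^ m) (ℕₚ.+-identityʳ M))

  ∈-net : ∀ {M p q} → NetPoint M p q → (fromℚ p , fromℚ q) ∈ net M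
  ∈-net (netPoint {k} {j} {i} {i′} refl i< i′< refl refl) =
    subst (λ m → (fromℚ (grid k i) , fromℚ (grid j i′)) ∈ cells m 0) (ℕₚ.+-comm j k) (∈-cells j k 0
      (subst (λ m → (fromℚ (grid k i) , fromℚ (grid j i′)) ∈ cell k m) (sym (ℕₚ.+-identityʳ j))
        (∈ₚ.∈-cartesianProduct⁺ (∈ₚ.∈-map⁺ (λ i → fromℚ (grid k i)) (∈ₚ.∈-upTo⁺ i<))
                                (∈ₚ.∈-map⁺ (λ i → fromℚ (grid j i)) (∈ₚ.∈-upTo⁺ i′<)))))

  net-⊆ : ∀ M → All ℐ² (net M)
  net-⊆ M = cells-⊆ M 0

-- The measure of a box

square : ℝ × ℝ → (r : ℚ) → 0ℚ ℚ.≤ r → AxisRectangle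
square (x , y) r 0≤r = record
  { x₀ = x - fromℚ r ; x₁ = x + fromℚ r ; y₀ = y - fromℚ r ; y₁ = y + fromℚ r
  ; x₀≤x₁ = widen x ; y₀≤y₁ = widen y }
  where
  widen : ∀ z → z - fromℚ r ≤ z + fromℚ r
  widen z = ≤-cert (fromℚ (r ℚ.+ r)) (fromℚ-mono (Q.+-nonneg 0≤r 0≤r)) λ n →
    solve 2 (λ z r → z :+ r := z :- r :+ (r :+ r)) refl (seq z n) r

square-area : ∀ c r 0≤r n → seq (AxisRectangle.area (square c r 0≤r)) n ≡ 4ℚ ℚ.* (r ℚ.* r)
square-area (x , y) r _ n = solve 3 (λ x y r →
  (x :+ r :- (x :- r)) :* (y :+ r :- (y :- r)) := con 4ℚ :* (r :* r)) refl (seq x n) (seq y n) r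

square-points : ∀ {x y c d r 0≤r} → Within r (x - c) → Within r (y - d) →
  AxisRectangle.points (square (c , d) r 0≤r) (x , y)
square-points {x} {y} {c} {d} {r} h k = side x c h , side y d k
  where
  side : ∀ z c → Within r (z - c) → c - fromℚ r ≤ z × z ≤ c + fromℚ r
  side z c h =
    ≤-cert _ (lower h) (λ n → solve 3 (λ z c r → z := c :- r :+ (r :+ (z :- c))) refl (seq z n) (seq c n) r) ,
    ≤-cert _ (upper h) (λ n → solve 3 (λ z c r → c :+ r := z :+ (r :- (z :- c))) refl (seq z n) (seq c n) r)

-- `≤μ₂` speaks of infinite covers, so a finite one is continued by degenerate squares of half-side
-- 0.
upToThen0 : ℚ → ℕ → ℕ → ℚ
upToThen0 r zero    _       = 0ℚ
upToThen0 r (suc n) zero    = r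
upToThen0 r (suc n) (suc i) = upToThen0 r n i

upToThen0-< : ∀ r {n i} → i ℕ.< n → upToThen0 r n i ≡ r
upToThen0-< r {suc n} {zero}  _           = refl
upToThen0-< r {suc n} {suc i} (ℕ.s≤s i<n) = upToThen0-< r i<n

upToThen0-nonneg : ∀ {r} → 0ℚ ℚ.≤ r → ∀ n i → 0ℚ ℚ.≤ upToThen0 r n i
upToThen0-nonneg 0≤r zero    _       = ℚₚ.≤-refl
upToThen0-nonneg 0≤r (suc n) zero    = 0≤r
upToThen0-nonneg 0≤r (suc n) (suc i) = upToThen0-nonneg 0≤r n i

upToThen0-step : ∀ r n i → Q.fromℕ (suc i ⊓ n) ℚ.* (4ℚ ℚ.* (r ℚ.* r)) ≡
  Q.fromℕ (i ⊓ n) ℚ.* (4ℚ ℚ.* (r ℚ.* r)) ℚ.+ 4ℚ ℚ.* (upToThen0 r n i ℚ.* upToThen0 r n i)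
upToThen0-step r zero zero = solve 1 (λ c → con 0ℚ :* c := con 0ℚ :* c :+ con 0ℚ) refl (4ℚ ℚ.* (r ℚ.* r))
upToThen0-step r zero (suc i) = solve 1 (λ c → con 0ℚ :* c := con 0ℚ :* c :+ con 0ℚ) refl (4ℚ ℚ.* (r ℚ.* r))
upToThen0-step r (suc n) zero = solve 1 (λ c → (con 1ℚ :+ con 0ℚ) :* c := con 0ℚ :* c :+ c) refl (4ℚ ℚ.* (r ℚ.* r))
upToThen0-step r (suc n) (suc i) = trans
  (solve 2 (λ a c → (con 1ℚ :+ a) :* c := c :+ a :* c) refl (Q.fromℕ (suc i ⊓ n)) (4ℚ ℚ.* (r ℚ.* r)))
  (trans (cong (4ℚ ℚ.* (r ℚ.* r) ℚ.+_) (upToThen0-step r n i))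
    (solve 3 (λ a c e → c :+ (a :* c :+ e) := (con 1ℚ :+ a) :* c :+ e) refl
      (Q.fromℕ (i ⊓ n)) (4ℚ ℚ.* (r ℚ.* r)) _))

squares : (ℕ → ℝ × ℝ) → (r : ℚ) → 0ℚ ℚ.≤ r → ℕ → ℕ → AxisRectangle
squares c r 0≤r n i = square (c i) (upToThen0 r n i) (upToThen0-nonneg 0≤r n i)

squares-sum : ∀ c r 0≤r n m j → seq (partialSum (λ i → AxisRectangle.area (squares c r 0≤r n i)) m) j ≡
  Q.fromℕ (m ⊓ n) ℚ.* (4ℚ ℚ.* (r ℚ.* r))
squares-sum c r 0≤r n zero    j = sym (ℚₚ.*-zeroˡ (4ℚ ℚ.* (r ℚ.* r)))
squares-sum c r 0≤r n (suc m) j = trans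
  (cong₂ ℚ._+_ (squares-sum c r 0≤r n m j) (square-area (c m) _ (upToThen0-nonneg 0≤r n m) j))
  (sym (upToThen0-step r n m))

squares-sumsTo : ∀ c r 0≤r n → (λ i → AxisRectangle.area (squares c r 0≤r n i)) sumsTo
  fromℚ (Q.fromℕ n ℚ.* (4ℚ ℚ.* (r ℚ.* r)))
squares-sumsTo c r 0≤r n δ 0<δ = n , λ m n≤m →
  let eq = λ j → trans (squares-sum c r 0≤r n m j)
        (cong (λ k → Q.fromℕ k ℚ.* (4ℚ ℚ.* (r ℚ.* r))) (ℕₚ.m≥n⇒m⊓n≡n n≤m))
  in ≤-cert δ (<⇒≤ 0<δ) (λ j → cong (ℚ._+ seq δ j) (sym (eq j))) ,
     ≤-cert δ (<⇒≤ 0<δ) (λ j → cong (ℚ._+ seq δ j) (eq j))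

-- Rounding `s` to a multiple of `h` assigns each point to one of `n` squares of half-side `6 * h`.
-- As `n * h = 4 * dy l`, their total area is `n * 4 * 36 * h² = 576 * dy l * dy k`; 576 is rounded
-- up to a power of two, so that it counts as ten levels.
tube-measure : ∀ {ε l k} (A : Pred ℝ² 0ℓ) {X Y p q p′ q′ : ℝ} → l ℕ.≤ k →
  Within 1ℚ p → Within 1ℚ q → Within 1ℚ p′ → Within 1ℚ q′ →
  (∀ {x y} → A (x , y) → ∃[ s ] ∃[ t ]
    (0ℝ ≤ s × s ≤ fromℚ (4ℚ ℚ.* dy l)) × (0ℝ ≤ t × t ≤ fromℚ (4ℚ ℚ.* dy k)) ×
    x ≃ X + (s * p + t * p′) × y ≃ Y + (s * q + t * q′)) →
  ε ≤μ₂ A → ε ≤ fromℚ (dy l ℚ.* dy k ℚ.* 1024ℚ)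
tube-measure {ε} {l} {k} A {X} {Y} {p} {q} {p′} {q′} l≤k |p|≤1 |q|≤1 |p′|≤1 |q′|≤1 coords ε≤A =
  ≤-trans (ε≤A (squares centre r 0≤r n) cover _ (squares-sumsTo centre r 0≤r n)) (fromℚ-mono bound)
  where
  h r : ℚ
  h = dy k
  -- `2 * h` is the rounding error in `s` and `4 * h` the range of `t`, each times a direction entry
  -- of absolute value at most 1.
  r = 2ℚ ℚ.* h ℚ.* 1ℚ ℚ.+ 4ℚ ℚ.* h ℚ.* 1ℚ
  0≤h : 0ℚ ℚ.≤ h
  0≤h = dy-nonneg k
  0≤4h : 0ℚ ℚ.≤ 4ℚ ℚ.* h
  0≤4h = Q.*-nonneg (from-yes (0ℚ ℚₚ.≤? 4ℚ)) 0≤h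
  0≤r : 0ℚ ℚ.≤ r
  0≤r = Q.+-nonneg (Q.*-nonneg (Q.*-nonneg (from-yes (0ℚ ℚₚ.≤? 2ℚ)) 0≤h) (ℚₚ.<⇒≤ Q.0<1))
                   (Q.*-nonneg 0≤4h (ℚₚ.<⇒≤ Q.0<1))
  n : ℕ
  n = 2 ℕ.^ (2 ℕ.+ (k ℕ.∸ l))
  centre : ℕ → ℝ × ℝ
  centre i = X + fromℚ (Q.fromℕ i ℚ.* h) * p , Y + fromℚ (Q.fromℕ i ℚ.* h) * q
  nh≡4dyl : Q.fromℕ n ℚ.* h ≡ 4ℚ ℚ.* dy l
  nh≡4dyl = trans (cong (Q.fromℕ n ℚ.*_) (trans (cong dy (sym (ℕₚ.m∸n+n≡m l≤k))) (dy-+ (k ℕ.∸ l) l)))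
    (trans (solve 3 (λ a b c → a :* (b :* c) := a :* (con ½ :* (con ½ :* b)) :* (con 4ℚ :* c)) refl
        (Q.fromℕ n) (dy (k ℕ.∸ l)) (dy l))
      (trans (cong (ℚ._* (4ℚ ℚ.* dy l)) (2^-dy (2 ℕ.+ (k ℕ.∸ l)))) (ℚₚ.*-identityˡ _)))
  offset : ∀ {x Z s t p p′} i → Within (2ℚ ℚ.* h) (s - fromℚ (Q.fromℕ i ℚ.* h)) → Within (4ℚ ℚ.* h) t →
    Within 1ℚ p → Within 1ℚ p′ → x ≃ Z + (s * p + t * p′) → Within r (x - (Z + fromℚ (Q.fromℕ i ℚ.* h) * p))
  offset {x} {Z} {s} {t} {p} {p′} i hs ht hp hp′ eq =
    within-≃ (≃-modulo {z = Z + (s * p + t * p′)} {w = x} 1ℝ (≃-sym eq) λ n →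
        solve 7 (λ x Z s t p p′ a → (s :- a) :* p :+ t :* p′ :=
          x :- (Z :+ a :* p) :+ con 1ℚ :* (Z :+ (s :* p :+ t :* p′) :- x)) refl
          (seq x n) (seq Z n) (seq s n) (seq t n) (seq p n) (seq p′ n) (Q.fromℕ i ℚ.* h))
      (within-+ (within-* hs hp) (within-* ht hp′))
  Coordinates : ℝ → ℝ → ℝ → ℝ → Set
  Coordinates x y s t = x ≃ X + (s * p + t * p′) × y ≃ Y + (s * q + t * q′)
  cover-at : ∀ {x y s t} → Coordinates x y s t → Within (4ℚ ℚ.* h) t →
    ∃[ i ] i ℕ.< n × Within (2ℚ ℚ.* h) (s - fromℚ (Q.fromℕ i ℚ.* h)) →
    ∃[ i ] AxisRectangle.points (squares centre r 0≤r n i) (x , y)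
  cover-at {x} {y} {s} {t} (x≃ , y≃) ht (i , i<n , hs) = i , square-points {0≤r = upToThen0-nonneg 0≤r n i}
    (subst (λ r → Within r (x - (X + fromℚ (Q.fromℕ i ℚ.* h) * p))) (sym (upToThen0-< r i<n))
      (offset {x} {X} {s} {t} {p} {p′} i hs ht |p|≤1 |p′|≤1 x≃))
    (subst (λ r → Within r (y - (Y + fromℚ (Q.fromℕ i ℚ.* h) * q))) (sym (upToThen0-< r i<n))
      (offset {y} {Y} {s} {t} {q} {q′} i hs ht |q|≤1 |q′|≤1 y≃))
  cover : ∀ {z} → A z → ∃[ i ] AxisRectangle.points (squares centre r 0≤r n i) z
  cover {x , y} z∈A =
    let (s , t , (0≤s , s≤) , (0≤t , t≤) , xy) = coords z∈A
    in cover-at {x} {y} {s} {t} xy (between⇒within 0≤4h 0≤t t≤)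
         (locate {h} {s} (dy-pos k) 0≤s n {{ℕₚ.m^n≢0 2 (2 ℕ.+ (k ℕ.∸ l))}}
           (≤-trans s≤ (fromℚ-mono (ℚₚ.≤-reflexive (sym nh≡4dyl)))))
  bound : Q.fromℕ n ℚ.* (4ℚ ℚ.* (r ℚ.* r)) ℚ.≤ dy l ℚ.* dy k ℚ.* 1024ℚ
  -- `64 * 7 = 448` is the slack `1024 - 576`.
  bound = cert-ℚ (dy l ℚ.* dy k ℚ.* (64ℚ ℚ.* 7ℚ))
      (Q.*-nonneg (Q.*-nonneg (dy-nonneg l) (dy-nonneg k)) (from-yes (0ℚ ℚₚ.≤? (64ℚ ℚ.* 7ℚ))))
      (trans (solve 2 (λ a h → a :* h :* con 1024ℚ :=
            (con 4ℚ :* a) :* (h :* con c) :+ a :* h :* con (64ℚ ℚ.* 7ℚ)) refl (dy l) h)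
        (cong (ℚ._+ dy l ℚ.* dy k ℚ.* (64ℚ ℚ.* 7ℚ))
          (trans (cong (ℚ._* (h ℚ.* c)) (sym nh≡4dyl))
            (solve 2 (λ N h → let r = con 2ℚ :* h :* con 1ℚ :+ con 4ℚ :* h :* con 1ℚ in
              (N :* h) :* (h :* con c) := N :* (con 4ℚ :* (r :* r))) refl (Q.fromℕ n) h))))
    where
    c : ℚ
    c = 4ℚ ℚ.* ((2ℚ ℚ.+ 4ℚ) ℚ.* (2ℚ ℚ.+ 4ℚ))

-- The squared bounds add up to `a² ≤ 2`, and `a ≤ 1 + a² / 4` avoids the square root. The generous
-- value 4 is the starting bound of `dyadic-scale-pos`.
side≤4 : ∀ {a u v} → u * u + v * v ≃ 1ℝ → Within 1ℚ (a * u) → Within 1ℚ (a * v) → a ≤ fromℚ 4ℚ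
side≤4 {a} {u} {v} unit hu hv = ≤-cert
  ((fromℚ ½ * a - 1ℝ) * (fromℚ ½ * a - 1ℝ) + (fromℚ ¼ * ((fromℚ (1ℚ ℚ.* 1ℚ) - (a * u) * (a * u)) +
    ((fromℚ (1ℚ ℚ.* 1ℚ) - (a * v) * (a * v)) + (a * a) * (u * u + v * v - 1ℝ))) + fromℚ (2ℚ ℚ.+ ½)))
  (+-nonneg (square-nonneg _) (+-nonneg (*-nonneg (fromℚ-mono (from-yes (0ℚ ℚₚ.≤? ¼)))
    (+-nonneg (upper (within-* hu hu)) (+-nonneg (upper (within-* hv hv))
      (*-nonneg (square-nonneg a) (diff-nonneg (≃⇒≤ (≃-sym unit)))))))
    (fromℚ-mono (from-yes (0ℚ ℚₚ.≤? (2ℚ ℚ.+ ½)))))) λ n →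
  solve 3 (λ a u v → con 4ℚ := a :+ ((con ½ :* a :- con 1ℚ) :* (con ½ :* a :- con 1ℚ) :+
    (con ¼ :* ((con (1ℚ ℚ.* 1ℚ) :- (a :* u) :* (a :* u)) :+ ((con (1ℚ ℚ.* 1ℚ) :- (a :* v) :* (a :* v)) :+
      (a :* a) :* (u :* u :+ v :* v :- con 1ℚ))) :+ con (2ℚ ℚ.+ ½)))) refl (seq a n) (seq u n) (seq v n)

ℐ-within : ∀ {x y z} → ℐ x → ℐ y → z ≃ y - x → Within 1ℚ z
ℐ-within {x} {y} {z} (x₀ , x₁) (y₀ , y₁) eq = within-≃ (≃-sym eq) (within
  (≤-cert₂ _ _ (diff-nonneg x₁) (diff-nonneg y₀) λ n →
    solve 2 (λ x y → con 1ℚ :+ (y :- x) := con 0ℚ :+ (con ½ :- x :+ (y :- con (ℚ.- ½)))) refl (seq x n) (seq y n))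
  (≤-cert₂ _ _ (diff-nonneg x₀) (diff-nonneg y₁) λ n →
    solve 2 (λ x y → con 1ℚ :- (y :- x) := con 0ℚ :+ (x :- con (ℚ.- ½) :+ (con ½ :- y))) refl (seq x n) (seq y n)))

-- Boxes inside the square

module BoxInSquare (B : Rectangle) (B⊆ : Rectangle.points B ⊆ ℐ²) where
  open Rectangle B

  cx cy X Y : ℝ
  cx = proj₁ corner
  cy = proj₂ corner
  X = cx + fromℚ ½ * (a * u - b * v)
  Y = cy + fromℚ ½ * (a * v + b * u)

  0≤a : 0ℝ ≤ a
  0≤a = <⇒≤ a>0

  0≤b : 0ℝ ≤ b
  0≤b = <⇒≤ b>0

  vertex : ∀ s t → 0ℝ ≤ s × s ≤ a → 0ℝ ≤ t × t ≤ b → ℐ² (cx + (s * u - t * v) , cy + (s * v + t * u))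
  vertex s t hs ht = B⊆ (s , t , hs , ht , ≃-refl , ≃-refl)

  -- The differences of these three vertices give both edge vectors, up to sign.
  v₀₀ = vertex 0ℝ 0ℝ (≤-refl , 0≤a) (≤-refl , 0≤b)
  v₁₀ = vertex a 0ℝ (0≤a , ≤-refl) (≤-refl , 0≤b)
  v₀₁ = vertex 0ℝ b (≤-refl , 0≤a) (0≤b , ≤-refl)

  a≤4 : a ≤ fromℚ 4ℚ
  a≤4 = side≤4 unit
    (ℐ-within (proj₁ v₀₀) (proj₁ v₁₀) (≃-pointwise λ n →
      solve 4 (λ c a u v → a :* u := c :+ (a :* u :- con 0ℚ :* v) :- (c :+ (con 0ℚ :* u :- con 0ℚ :* v))) refl
        (seq cx n) (seq a n) (seq u n) (seq v n)))
    (ℐ-within (proj₂ v₀₀) (proj₂ v₁₀) (≃-pointwise λ n →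
      solve 4 (λ c a u v → a :* v := c :+ (a :* v :+ con 0ℚ :* u) :- (c :+ (con 0ℚ :* v :+ con 0ℚ :* u))) refl
        (seq cy n) (seq a n) (seq u n) (seq v n)))

  b≤4 : b ≤ fromℚ 4ℚ
  b≤4 = side≤4 unit
    (ℐ-within (proj₂ v₀₀) (proj₂ v₀₁) (≃-pointwise λ n →
      solve 4 (λ c b u v → b :* u := c :+ (con 0ℚ :* v :+ b :* u) :- (c :+ (con 0ℚ :* v :+ con 0ℚ :* u))) refl
        (seq cy n) (seq b n) (seq u n) (seq v n)))
    (ℐ-within (proj₁ v₀₁) (proj₁ v₀₀) (≃-pointwise λ n →
      solve 4 (λ c b u v → b :* v := c :+ (con 0ℚ :* u :- con 0ℚ :* v) :- (c :+ (con 0ℚ :* u :- b :* v))) refl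
        (seq cx n) (seq b n) (seq u n) (seq v n)))

  -- The box is shrunk about its centre. As the centre is half a diagonal away from the corner, the
  -- corner coordinate `s` exceeds the centred one by `½ * a * (u² + v²)`, and similarly for `t`;
  -- hence the vanishing terms with `u² + v² - 1`.
  inBox⇒points : ∀ {α β x y} → fromℚ α ≤ a → fromℚ β ≤ b →
    InBox X Y u v (½ ℚ.* α) (½ ℚ.* β) x y → points (x , y)
  inBox⇒points {α} {β} {x} {y} α≤a β≤b (inBox along across) = s , t ,
    ( ≤-cert (fromℚ (½ ℚ.* α) + form X Y u v x y + (fromℚ ½ * (a - fromℚ α) + fromℚ ½ * (a * (u * u + v * v - 1ℝ))))
        (+-nonneg (lower along) (rest α≤a 0≤a (≃-sym unit))) (λ n →
        solve 9 (λ x y cx cy u v a b α →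
          let X = cx :+ con ½ :* (a :* u :- b :* v) ; Y = cy :+ con ½ :* (a :* v :+ b :* u) in
          (x :- cx) :* u :+ (y :- cy) :* v := con 0ℚ :+ (con ½ :* α :+ ((x :- X) :* u :+ (y :- Y) :* v) :+
            (con ½ :* (a :- α) :+ con ½ :* (a :* (u :* u :+ v :* v :- con 1ℚ))))) refl
          (seq x n) (seq y n) (seq cx n) (seq cy n) (seq u n) (seq v n) (seq a n) (seq b n) α)
    , ≤-cert (fromℚ (½ ℚ.* α) - form X Y u v x y + (fromℚ ½ * (a - fromℚ α) + fromℚ ½ * (a * (1ℝ - (u * u + v * v)))))
        (+-nonneg (upper along) (rest α≤a 0≤a unit)) (λ n →
        solve 9 (λ x y cx cy u v a b α →
          let X = cx :+ con ½ :* (a :* u :- b :* v) ; Y = cy :+ con ½ :* (a :* v :+ b :* u) in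
          a := (x :- cx) :* u :+ (y :- cy) :* v :+ (con ½ :* α :- ((x :- X) :* u :+ (y :- Y) :* v) :+
            (con ½ :* (a :- α) :+ con ½ :* (a :* (con 1ℚ :- (u :* u :+ v :* v)))))) refl
          (seq x n) (seq y n) (seq cx n) (seq cy n) (seq u n) (seq v n) (seq a n) (seq b n) α) ) ,
    ( ≤-cert (fromℚ (½ ℚ.* β) + form X Y (- v) u x y + (fromℚ ½ * (b - fromℚ β) + fromℚ ½ * (b * (u * u + v * v - 1ℝ))))
        (+-nonneg (lower across) (rest β≤b 0≤b (≃-sym unit))) (λ n →
        solve 9 (λ x y cx cy u v a b β →
          let X = cx :+ con ½ :* (a :* u :- b :* v) ; Y = cy :+ con ½ :* (a :* v :+ b :* u) in
          (y :- cy) :* u :- (x :- cx) :* v := con 0ℚ :+ (con ½ :* β :+ ((x :- X) :* :- v :+ (y :- Y) :* u) :+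
            (con ½ :* (b :- β) :+ con ½ :* (b :* (u :* u :+ v :* v :- con 1ℚ))))) refl
          (seq x n) (seq y n) (seq cx n) (seq cy n) (seq u n) (seq v n) (seq a n) (seq b n) β)
    , ≤-cert (fromℚ (½ ℚ.* β) - form X Y (- v) u x y + (fromℚ ½ * (b - fromℚ β) + fromℚ ½ * (b * (1ℝ - (u * u + v * v)))))
        (+-nonneg (upper across) (rest β≤b 0≤b unit)) (λ n →
        solve 9 (λ x y cx cy u v a b β →
          let X = cx :+ con ½ :* (a :* u :- b :* v) ; Y = cy :+ con ½ :* (a :* v :+ b :* u) in
          b := (y :- cy) :* u :- (x :- cx) :* v :+ (con ½ :* β :- ((x :- X) :* :- v :+ (y :- Y) :* u) :+
            (con ½ :* (b :- β) :+ con ½ :* (b :* (con 1ℚ :- (u :* u :+ v :* v)))))) refl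
          (seq x n) (seq y n) (seq cx n) (seq cy n) (seq u n) (seq v n) (seq a n) (seq b n) β) ) ,
    ≃-modulo {z = 1ℝ} {w = u * u + v * v} (x - cx) (≃-sym unit) (λ n →
      solve 6 (λ x y cx cy u v → x := cx :+ (((x :- cx) :* u :+ (y :- cy) :* v) :* u :- ((y :- cy) :* u :- (x :- cx) :* v) :* v)
        :+ (x :- cx) :* (con 1ℚ :- (u :* u :+ v :* v))) refl
        (seq x n) (seq y n) (seq cx n) (seq cy n) (seq u n) (seq v n)) ,
    ≃-modulo {z = 1ℝ} {w = u * u + v * v} (y - cy) (≃-sym unit) (λ n →
      solve 6 (λ x y cx cy u v → y := cy :+ (((x :- cx) :* u :+ (y :- cy) :* v) :* v :+ ((y :- cy) :* u :- (x :- cx) :* v) :* u)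
        :+ (y :- cy) :* (con 1ℚ :- (u :* u :+ v :* v))) refl
        (seq x n) (seq y n) (seq cx n) (seq cy n) (seq u n) (seq v n))
    where
    s t : ℝ
    s = (x - cx) * u + (y - cy) * v
    t = (y - cy) * u - (x - cx) * v
    rest : ∀ {γ c z w} → fromℚ γ ≤ c → 0ℝ ≤ c → z ≃ w → 0ℝ ≤ fromℚ ½ * (c - fromℚ γ) + fromℚ ½ * (c * (w - z))
    rest γ≤c 0≤c z≃w = +-nonneg (*-nonneg (fromℚ-mono 0≤½) (diff-nonneg γ≤c))
      (*-nonneg (fromℚ-mono 0≤½) (*-nonneg 0≤c (diff-nonneg (≃⇒≤ z≃w))))

  box-measure : ∀ {ε l k} (A : Pred ℝ² 0ℓ) → A ⊆ points → a ≤ fromℚ (4ℚ ℚ.* dy l) → b ≤ fromℚ (4ℚ ℚ.* dy k) →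
    ε ≤μ₂ A → ε ≤ fromℚ (dy l ℚ.* dy k ℚ.* 1024ℚ)
  box-measure {ε} {l} {k} A A⊆ a≤ b≤ ε≤A = Sum.[ long-a , long-b ]′ (ℕₚ.≤-total l k)
    where
    |u|≤1 = within-unit unit
    |v|≤1 = within-unit (unit-swap unit)
    |-v|≤1 = within-neg |v|≤1
    long-a : l ℕ.≤ k → ε ≤ fromℚ (dy l ℚ.* dy k ℚ.* 1024ℚ)
    long-a l≤k = tube-measure {l = l} {k} A {cx} {cy} l≤k |u|≤1 |v|≤1 |-v|≤1 |u|≤1 (λ z∈A →
      let (s , t , (0≤s , s≤a) , (0≤t , t≤b) , x≃ , y≃) = A⊆ z∈A
      in s , t , (0≤s , ≤-trans s≤a a≤) , (0≤t , ≤-trans t≤b b≤) ,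
         ≃-trans x≃ (≃-pointwise λ n → solve 5 (λ c s t u v → c :+ (s :* u :- t :* v) := c :+ (s :* u :+ t :* :- v)) refl
           (seq cx n) (seq s n) (seq t n) (seq u n) (seq v n)) , y≃) ε≤A
    long-b : k ℕ.≤ l → ε ≤ fromℚ (dy l ℚ.* dy k ℚ.* 1024ℚ)
    long-b k≤l = ≤-trans (tube-measure {l = k} {l} A {cx} {cy} k≤l |-v|≤1 |u|≤1 |u|≤1 |v|≤1 (λ z∈A →
      let (s , t , (0≤s , s≤a) , (0≤t , t≤b) , x≃ , y≃) = A⊆ z∈A
      in t , s , (0≤t , ≤-trans t≤b b≤) , (0≤s , ≤-trans s≤a a≤) ,
         ≃-trans x≃ (≃-pointwise λ n → solve 5 (λ c s t u v → c :+ (s :* u :- t :* v) := c :+ (t :* :- v :+ s :* u)) refl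
           (seq cx n) (seq s n) (seq t n) (seq u n) (seq v n)) ,
         ≃-trans y≃ (≃-pointwise λ n → solve 5 (λ c s t u v → c :+ (s :* v :+ t :* u) := c :+ (t :* u :+ s :* v)) refl
           (seq cy n) (seq s n) (seq t n) (seq u n) (seq v n))) ε≤A)
      (fromℚ-mono (ℚₚ.≤-reflexive (cong (ℚ._* 1024ℚ) (ℚₚ.*-comm (dy k) (dy l)))))

-- 18 = 10 + 8: ten levels are lost to the factor 1024 in box-measure and eight in hit-box.
net-hits : ∀ {ε m} {R : Pred ℝ² 0ℓ} → fromℚ (dy m) ≤ ε → IsBox R → R ⊆ ℐ² → ε ≤μ₂ R →
  ∃[ p ] ∃[ q ] NetPoint (18 ℕ.+ m) p q × R (fromℚ p , fromℚ q)
net-hits {ε} {m} {R} dym≤ε (B , R⊆B , B⊆R) R⊆ ε≤R =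
  -- The upper bounds on the sides enter the measure estimate, the lower ones the inscribed box
  -- given to `hit-box`.
  let (l , ≤a , a≤) = dyadic-scale-pos a>0 a≤4
      (k , ≤b , b≤) = dyadic-scale-pos b>0 b≤4
      1024·dym≤ = fromℚ-cancel (≤-trans dym≤ε (box-measure {l = l} {k} R R⊆B a≤ b≤ ε≤R))
      (p , q , pt , h) = hit-box {X} {Y} {u} {v} {l} {k} {18 ℕ.+ m}
        (ℕₚ.+-monoʳ-≤ 8 (dy-cancel (size l k 1024·dym≤))) unit
        (λ x y h → R⊆ (B⊆R (inBox⇒points ≤a ≤b h)))
  in p , q , pt , B⊆R (inBox⇒points ≤a ≤b h)
  where
  open Rectangle B
  open BoxInSquare B (λ z∈B → R⊆ (B⊆R z∈B))
  size : ∀ l k → dy m ℚ.≤ dy l ℚ.* dy k ℚ.* 1024ℚ → dy (10 ℕ.+ m) ℚ.≤ dy (l ℕ.+ k)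
  size l k h = subst₂ ℚ._≤_ (sym (dy-+ 10 m))
    (trans (solve 1 (λ d → con (dy 10) :* (d :* con (1024ℚ)) := d) refl (dy l ℚ.* dy k)) (sym (dy-+ l k)))
    (ℚₚ.*-monoˡ-≤-nonNeg (dy 10) {{ℚ.nonNegative (dy-nonneg 10)}} h)

-- Lower bounds for the logarithm

odd⁻¹ : ℕ → ℚ
odd⁻¹ k = ℤ.+ 1 ℚ./ suc (2 ℕ.* k)

1/n*n : ∀ d → (ℤ.+ 1 ℚ./ suc d) ℚ.* Q.fromℕ (suc d) ≡ 1ℚ
1/n*n d = trans (cong ((ℤ.+ 1 ℚ./ suc d) ℚ.*_) (Q.fromℕ-/ (suc d))) (ℚₚ.toℚᵘ-injective
  (ℚᵘₚ.≃-trans (ℚₚ.toℚᵘ-homo-* (ℤ.+ 1 ℚ./ suc d) (ℤ.+ suc d ℚ./ 1))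
  (ℚᵘₚ.≃-trans (ℚᵘₚ.*-cong (ℚₚ.toℚᵘ-fromℚᵘ (mkℚᵘ (ℤ.+ 1) d)) (ℚₚ.toℚᵘ-fromℚᵘ (mkℚᵘ (ℤ.+ suc d) 0)))
    (*≡* (trans (ℤₚ.*-identityʳ (ℤ.+ 1 ℤ.* ℤ.+ suc d))
      (cong (ℤ.+ 1 ℤ.*_) (cong ℤ.+_ (sym (ℕₚ.*-identityʳ (suc d))))))))))

odd⁻¹-nonneg : ∀ k → 0ℚ ℚ.≤ odd⁻¹ k
odd⁻¹-nonneg k = ℚₚ.nonNegative⁻¹ _ {{ℚₚ.normalize-nonNeg 1 (suc (2 ℕ.* k))}}

dy≤odd⁻¹ : ∀ {k m} → suc (2 ℕ.* k) ℕ.≤ 2 ℕ.^ m → dy m ℚ.≤ odd⁻¹ k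
dy≤odd⁻¹ {k} {m} h = cert-ℚ (odd⁻¹ k ℚ.* ((Q.fromℕ (2 ℕ.^ m) ℚ.- Q.fromℕ (suc (2 ℕ.* k))) ℚ.* dy m))
  (Q.*-nonneg (odd⁻¹-nonneg k) (Q.*-nonneg (Q.diff-nonneg (fromℕ-mono h)) (dy-nonneg m)))
  (trans (trans (sym (ℚₚ.*-identityʳ (odd⁻¹ k))) (cong (odd⁻¹ k ℚ.*_) (sym (2^-dy m))))
    (trans (solve 4 (λ w N n d → w :* (N :* d) := (w :* n) :* d :+ w :* ((N :- n) :* d)) refl
        (odd⁻¹ k) (Q.fromℕ (2 ℕ.^ m)) (Q.fromℕ (suc (2 ℕ.* k))) (dy m))
      (cong (ℚ._+ odd⁻¹ k ℚ.* ((Q.fromℕ (2 ℕ.^ m) ℚ.- Q.fromℕ (suc (2 ℕ.* k))) ℚ.* dy m))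
        (trans (cong (ℚ._* dy m) (1/n*n (2 ℕ.* k))) (ℚₚ.*-identityˡ (dy m))))))

^-nonneg : ∀ {z} → 0ℚ ℚ.≤ z → ∀ n → 0ℚ ℚ.≤ z ^ n
^-nonneg 0≤z zero    = ℚₚ.<⇒≤ Q.0<1
^-nonneg 0≤z (suc n) = Q.*-nonneg 0≤z (^-nonneg 0≤z n)

artanhTerm-nonneg : ∀ {z} → 0ℚ ℚ.≤ z → ∀ k → 0ℚ ℚ.≤ z ^ suc (2 ℕ.* k) ℚ.* odd⁻¹ k
artanhTerm-nonneg 0≤z k = Q.*-nonneg (^-nonneg 0≤z (suc (2 ℕ.* k))) (odd⁻¹-nonneg k)

artanhSum-mono-+ : ∀ {z} → 0ℚ ℚ.≤ z → ∀ k d → artanhSum k z ℚ.≤ artanhSum (d ℕ.+ k) z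
artanhSum-mono-+ 0≤z k zero    = ℚₚ.≤-refl
artanhSum-mono-+ 0≤z k (suc d) = ℚₚ.≤-trans (artanhSum-mono-+ 0≤z k d)
  (cert-ℚ _ (artanhTerm-nonneg 0≤z (d ℕ.+ k)) refl)

artanhSum-mono : ∀ {z k n} → 0ℚ ℚ.≤ z → k ℕ.≤ n → artanhSum k z ℚ.≤ artanhSum n z
artanhSum-mono {z} {k} {n} 0≤z k≤n =
  subst (λ m → artanhSum k z ℚ.≤ artanhSum m z) (ℕₚ.m∸n+n≡m k≤n) (artanhSum-mono-+ 0≤z k (n ℕ.∸ k))

module _ {q z : ℚ} (0≤q : 0ℚ ℚ.≤ q) (0≤z : 0ℚ ℚ.≤ z) (1-q≤z : 1ℚ ℚ.- q ℚ.≤ z) where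

  -- Bernoulli's inequality by induction; `n * q ≤ 1` gives the sign of the factor multiplying
  -- `z - (1 - q)`.
  bernoulli-lower : ∀ n → Q.fromℕ n ℚ.* q ℚ.≤ 1ℚ → 1ℚ ℚ.- Q.fromℕ n ℚ.* q ℚ.≤ z ^ n
  bernoulli-lower zero    _ = ℚₚ.≤-reflexive (solve 1 (λ q → con 1ℚ :- con 0ℚ :* q := con 1ℚ) refl q)
  bernoulli-lower (suc n) h = cert-ℚ
    (z ℚ.* (z ^ n ℚ.- (1ℚ ℚ.- Q.fromℕ n ℚ.* q)) ℚ.+
      ((z ℚ.- (1ℚ ℚ.- q)) ℚ.* (1ℚ ℚ.- Q.fromℕ n ℚ.* q) ℚ.+ Q.fromℕ n ℚ.* (q ℚ.* q)))
    (Q.+-nonneg (Q.*-nonneg 0≤z (Q.diff-nonneg (bernoulli-lower n h′)))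
      (Q.+-nonneg (Q.*-nonneg (Q.diff-nonneg 1-q≤z) (Q.diff-nonneg h′))
        (Q.*-nonneg (Q.fromℕ-nonneg n) (Q.*-nonneg 0≤q 0≤q))))
    (solve 4 (λ z t n q → z :* t := con 1ℚ :- (con 1ℚ :+ n) :* q :+ (z :* (t :- (con 1ℚ :- n :* q)) :+
      ((z :- (con 1ℚ :- q)) :* (con 1ℚ :- n :* q) :+ n :* (q :* q)))) refl z (z ^ n) (Q.fromℕ n) q)
    where
    h′ : Q.fromℕ n ℚ.* q ℚ.≤ 1ℚ
    h′ = ℚₚ.≤-trans (cert-ℚ q 0≤q (solve 2 (λ n q → (con 1ℚ :+ n) :* q := n :* q :+ q) refl (Q.fromℕ n) q)) h

  module _ {j : ℕ} (q≤ : q ℚ.≤ dy (3 ℕ.+ j)) where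

    -- `2 * k + 1` is at most `2²⁺ʲ`, so the power is at least `1 - 2²⁺ʲ * q ≥ ½` and the odd
    -- reciprocal at least `2⁻⁽²⁺ʲ⁾`.
    artanhTerm-lower : ∀ k → k ℕ.< 2 ℕ.^ suc j → dy (3 ℕ.+ j) ℚ.≤ z ^ suc (2 ℕ.* k) ℚ.* odd⁻¹ k
    artanhTerm-lower k k< = Q.*-mono 0≤½ (odd⁻¹-nonneg k)
      (ℚₚ.≤-trans (cert-ℚ (½ ℚ.- Q.fromℕ (suc (2 ℕ.* k)) ℚ.* q) (Q.diff-nonneg small)
        (solve 1 (λ a → con 1ℚ :- a := con ½ :+ (con ½ :- a)) refl (Q.fromℕ (suc (2 ℕ.* k)) ℚ.* q)))
        (bernoulli-lower (suc (2 ℕ.* k)) (ℚₚ.≤-trans small (from-yes (½ ℚₚ.≤? 1ℚ)))))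
      (dy≤odd⁻¹ {k} {2 ℕ.+ j} odd≤)
      where
      odd≤ : suc (2 ℕ.* k) ℕ.≤ 2 ℕ.^ (2 ℕ.+ j)
      odd≤ = ℕₚ.≤-trans (ℕₚ.n≤1+n _) (subst (ℕ._≤ 2 ℕ.^ (2 ℕ.+ j)) (ℕₚ.*-suc 2 k) (ℕₚ.*-monoʳ-≤ 2 k<))
      small : Q.fromℕ (suc (2 ℕ.* k)) ℚ.* q ℚ.≤ ½
      small = ℚₚ.≤-trans (Q.*-mono (Q.fromℕ-nonneg (suc (2 ℕ.* k))) (dy-nonneg (3 ℕ.+ j)) (fromℕ-mono odd≤) q≤)
        (ℚₚ.≤-reflexive (trans (solve 2 (λ N d → N :* (con ½ :* d) := con ½ :* (N :* d)) refl
            (Q.fromℕ (2 ℕ.^ (2 ℕ.+ j))) (dy (2 ℕ.+ j)))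
          (cong (½ ℚ.*_) (2^-dy (2 ℕ.+ j)))))

    artanhSum-block : ∀ k d → d ℕ.+ k ℕ.≤ 2 ℕ.^ suc j →
      artanhSum k z ℚ.+ Q.fromℕ d ℚ.* dy (3 ℕ.+ j) ℚ.≤ artanhSum (d ℕ.+ k) z
    artanhSum-block k zero    _ = ℚₚ.≤-reflexive
      (solve 2 (λ a d → a :+ con 0ℚ :* d := a) refl (artanhSum k z) (dy (3 ℕ.+ j)))
    artanhSum-block k (suc d) h = subst (ℚ._≤ artanhSum (suc d ℕ.+ k) z)
      (solve 3 (λ a n d → a :+ n :* d :+ d := a :+ (con 1ℚ :+ n) :* d) refl (artanhSum k z) (Q.fromℕ d) (dy (3 ℕ.+ j)))
      (ℚₚ.+-mono-≤ (artanhSum-block k d (ℕₚ.<⇒≤ h)) (artanhTerm-lower (d ℕ.+ k) h))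

  -- The terms with index in [2ʲ , 2ʲ⁺¹) contribute at least 1/8 together, as in the harmonic series.
  artanhSum-lower : ∀ j → q ℚ.≤ dy (2 ℕ.+ j) → Q.fromℕ j ℚ.* dy 3 ℚ.≤ artanhSum (2 ℕ.^ j) z
  artanhSum-lower zero    _ = artanhSum-mono {z} {0} {1} 0≤z ℕ.z≤n
  artanhSum-lower (suc j) q≤ = ℚₚ.≤-trans
    (subst (ℚ._≤ artanhSum (2 ℕ.^ j) z ℚ.+ Q.fromℕ (2 ℕ.^ j) ℚ.* dy (3 ℕ.+ j))
      (trans (cong (Q.fromℕ j ℚ.* dy 3 ℚ.+_) eighth)
        (solve 1 (λ n → n :* con (dy 3) :+ con (dy 3) := (con 1ℚ :+ n) :* con (dy 3)) refl (Q.fromℕ j)))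
      (ℚₚ.+-monoˡ-≤ (Q.fromℕ (2 ℕ.^ j) ℚ.* dy (3 ℕ.+ j))
        (artanhSum-lower j (ℚₚ.≤-trans q≤ (dy-anti-+ (2 ℕ.+ j) 1)))))
    (ℚₚ.≤-trans (artanhSum-block {j} q≤ (2 ℕ.^ j) (2 ℕ.^ j) (ℕₚ.≤-reflexive double))
      (ℚₚ.≤-reflexive (cong (λ m → artanhSum m z) double)))
    where
    double : 2 ℕ.^ j ℕ.+ 2 ℕ.^ j ≡ 2 ℕ.^ suc j
    double = cong (2 ℕ.^ j ℕ.+_) (sym (ℕₚ.+-identityʳ (2 ℕ.^ j)))
    eighth : Q.fromℕ (2 ℕ.^ j) ℚ.* dy (3 ℕ.+ j) ≡ dy 3
    eighth = trans (solve 2 (λ N d → N :* (con ½ :* (con ½ :* (con ½ :* d))) := con (dy 3) :* (N :* d)) refl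
      (Q.fromℕ (2 ℕ.^ j)) (dy j)) (trans (cong (dy 3 ℚ.*_) (2^-dy j)) (ℚₚ.*-identityʳ (dy 3)))

module _ (x : ℝ) (x>0 : 0ℝ < x) where

  -- The argument of the artanh series in ln x.
  lnArg : ℝ
  lnArg = (x - 1ℝ) * inv (x + 1ℝ) (1+-pos x x>0)

  -- `(x - 1) / (x + 1) = 1 - 2 / (x + 1)`, and the hypothesis says that the last fraction is at
  -- most `D`.
  lnArg-lower : ∀ {D} → 0ℚ ℚ.≤ 1ℚ ℚ.- D → fromℚ 2ℚ ≤ fromℚ D * (x + 1ℝ) → fromℚ (1ℚ ℚ.- D) ≤ lnArg
  lnArg-lower {D} 0≤1-D h = ≤-cert
    ((fromℚ D * (x + 1ℝ) - fromℚ 2ℚ) * ι + fromℚ (1ℚ ℚ.- D) * ((x + 1ℝ) * ι - 1ℝ))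
    (+-nonneg (*-nonneg (diff-nonneg h) (inv-nonneg _ (1+-pos x x>0)))
      (*-nonneg (fromℚ-mono 0≤1-D) (diff-nonneg (≃⇒≤ (≃-sym (*-inv _ (1+-pos x x>0))))))) λ n →
    solve 3 (λ x D ι → (x :- con 1ℚ) :* ι := con 1ℚ :- D :+
      ((D :* (x :+ con 1ℚ) :- con 2ℚ) :* ι :+ (con 1ℚ :- D) :* ((x :+ con 1ℚ) :* ι :- con 1ℚ))) refl
      (seq x n) D (seq ι n)
    where ι = inv (x + 1ℝ) (1+-pos x x>0)

  ln-lower : ∀ {r} → Eventually (λ n → r ℚ.≤ artanhSum n (seq lnArg n)) → fromℚ (2ℚ ℚ.* r) ≤ ln x x>0
  ln-lower {r} h = ≤-eventual {fromℚ (2ℚ ℚ.* r)} {ln x x>0}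
    (ev-map (λ n → ℚₚ.*-monoˡ-≤-nonNeg 2ℚ) h)

  -- One level, from `3 + j` to `2 + j`, is spent on carrying the bound on `lnArg` over to its
  -- representatives.
  ln-lower-log : ∀ {j} → fromℚ 2ℚ ≤ fromℚ (dy (3 ℕ.+ j)) * (x + 1ℝ) →
    fromℚ (2ℚ ℚ.* (Q.fromℕ j ℚ.* dy 3)) ≤ ln x x>0
  ln-lower-log {j} h = ln-lower (ev-zip
      (λ n 1-q≤z 2^j≤n →
        let 0≤z = ℚₚ.≤-trans (0≤1-dy (2 ℕ.+ j)) 1-q≤z in
        ℚₚ.≤-trans (artanhSum-lower (dy-nonneg (2 ℕ.+ j)) 0≤z 1-q≤z j ℚₚ.≤-refl) (artanhSum-mono 0≤z 2^j≤n))
      (eventually-above {1ℚ ℚ.- dy (3 ℕ.+ j)} {1ℚ ℚ.- dy (2 ℕ.+ j)} (lnArg-lower {dy (3 ℕ.+ j)} (0≤1-dy (3 ℕ.+ j)) h) dy<)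
      (2 ℕ.^ j , λ _ le → le))
    where
    0≤1-dy : ∀ k → 0ℚ ℚ.≤ 1ℚ ℚ.- dy k
    0≤1-dy k = Q.diff-nonneg (dy-anti {0} {k} ℕ.z≤n)
    dy< : 1ℚ ℚ.- dy (2 ℕ.+ j) ℚ.< 1ℚ ℚ.- dy (3 ℕ.+ j)
    dy< = subst₂ ℚ._<_ (ℚₚ.+-identityʳ _)
      (solve 1 (λ d → con 1ℚ :- d :+ con ½ :* d := con 1ℚ :- con ½ :* d) refl (dy (2 ℕ.+ j)))
      (ℚₚ.+-monoʳ-< (1ℚ ℚ.- dy (2 ℕ.+ j)) (dy-pos (3 ℕ.+ j)))

  -- Only the first term of the series is kept, which serves for arguments near 1. The loss of half
  -- of `1 - D` in passing to representatives cancels the factor 2 in `ln`.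
  ln-lower-const : ∀ {D} → 0ℚ ℚ.< 1ℚ ℚ.- D → fromℚ 2ℚ ≤ fromℚ D * (x + 1ℝ) → fromℚ (1ℚ ℚ.- D) ≤ ln x x>0
  ln-lower-const {D} 0<c h = ≤-trans
    (fromℚ-mono (ℚₚ.≤-reflexive (solve 1 (λ c → c := con 2ℚ :* (con ½ :* c)) refl (1ℚ ℚ.- D))))
    (ln-lower (ev-zip
      (λ n c≤z 1≤n → let 0≤z = ℚₚ.≤-trans (ℚₚ.<⇒≤ (half-pos 0<c)) c≤z in
        ℚₚ.≤-trans c≤z (ℚₚ.≤-trans
          (ℚₚ.≤-reflexive (solve 1 (λ z → z := con 0ℚ :+ z :* con 1ℚ :* con 1ℚ) refl (seq lnArg n)))
          (artanhSum-mono {seq lnArg n} {1} {n} 0≤z 1≤n)))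
      (eventually-above {1ℚ ℚ.- D} {½ ℚ.* (1ℚ ℚ.- D)} (lnArg-lower {D} (ℚₚ.<⇒≤ 0<c) h) c<)
      (1 , λ _ le → le)))
    where
    c< : ½ ℚ.* (1ℚ ℚ.- D) ℚ.< 1ℚ ℚ.- D
    c< = subst₂ ℚ._<_ (ℚₚ.+-identityʳ _)
      (solve 1 (λ c → con ½ :* c :+ con ½ :* c := c) refl (1ℚ ℚ.- D))
      (ℚₚ.+-monoʳ-< (½ ℚ.* (1ℚ ℚ.- D)) (half-pos 0<c))

-- The size of the net

module Reciprocal (ε : ℝ) (ε>0 : 0ℝ < ε) where

  I : ℝ
  I = inv ε ε>0

  0≤I : 0ℝ ≤ I
  0≤I = inv-nonneg ε ε>0

  0≤εI-1 : 0ℝ ≤ ε * I - 1ℝ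
  0≤εI-1 = diff-nonneg (≃⇒≤ (≃-sym (*-inv ε ε>0)))

  I-lower : ∀ {m} → ε ≤ fromℚ (4ℚ ℚ.* dy m) → fromℚ (¼ ℚ.* Q.fromℕ (2 ℕ.^ m)) ≤ I
  I-lower {m} ε≤ = ≤-cert
    (fromℚ (¼ ℚ.* P) * ((fromℚ (4ℚ ℚ.* dy m) - ε) * I) + fromℚ (¼ ℚ.* P) * (ε * I - 1ℝ))
    (+-nonneg (*-nonneg 0≤¼P (*-nonneg (diff-nonneg ε≤) 0≤I)) (*-nonneg 0≤¼P 0≤εI-1)) λ n →
    trans (sym (trans (cong (ℚ._* seq I n) (2^-dy m)) (ℚₚ.*-identityˡ (seq I n))))
      (solve 4 (λ p d e i → p :* d :* i := con ¼ :* p :+ (con ¼ :* p :* ((con 4ℚ :* d :- e) :* i) :+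
        con ¼ :* p :* (e :* i :- con 1ℚ))) refl P (dy m) (seq ε n) (seq I n))
    where
    P = Q.fromℕ (2 ℕ.^ m)
    0≤¼P = fromℚ-mono (Q.*-nonneg (from-yes (0ℚ ℚₚ.≤? ¼)) (Q.fromℕ-nonneg (2 ℕ.^ m)))

  -- `2 / (I + 1)` is below `2 * ε`, which is at most `8 * 2⁻⁽⁶⁺ʲ⁾ = 2⁻⁽³⁺ʲ⁾`; this explains the
  -- shift by 6.
  I-scale : ∀ {j} → ε ≤ fromℚ (4ℚ ℚ.* dy (6 ℕ.+ j)) → fromℚ 2ℚ ≤ fromℚ (dy (3 ℕ.+ j)) * (I + 1ℝ)
  I-scale {j} ε≤ = ≤-cert
    (fromℚ 2ℚ * ((fromℚ (4ℚ ℚ.* dy (6 ℕ.+ j)) - ε) * I) + (fromℚ (dy (3 ℕ.+ j)) + fromℚ 2ℚ * (ε * I - 1ℝ)))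
    (+-nonneg (*-nonneg 0≤2 (*-nonneg (diff-nonneg ε≤) 0≤I))
      (+-nonneg (fromℚ-mono (dy-nonneg (3 ℕ.+ j))) (*-nonneg 0≤2 0≤εI-1))) λ n →
    solve 3 (λ d e i → d :* (i :+ con 1ℚ) := con 2ℚ :+
      (con 2ℚ :* ((con 4ℚ :* (con ½ :* (con ½ :* (con ½ :* d))) :- e) :* i) :+ (d :+ con 2ℚ :* (e :* i :- con 1ℚ)))) refl
      (dy (3 ℕ.+ j)) (seq ε n) (seq I n)
    where 0≤2 = fromℚ-mono (from-yes (0ℚ ℚₚ.≤? 2ℚ))

  -- `ε * (1 + g) ≤ (1 - g) * (1 + g) = 1 - g² ≤ 1`.
  I-gap : ∀ {g} → 0ℚ ℚ.≤ g → ε ≤ fromℚ (1ℚ ℚ.- g) → fromℚ (1ℚ ℚ.+ g) ≤ I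
  I-gap {g} 0≤g ε≤ = ≤-cert
    (fromℚ (1ℚ ℚ.+ g) * ((fromℚ (1ℚ ℚ.- g) - ε) * I) + (fromℚ (g ℚ.* g) * I + fromℚ (1ℚ ℚ.+ g) * (ε * I - 1ℝ)))
    (+-nonneg (*-nonneg 0≤1+g (*-nonneg (diff-nonneg ε≤) 0≤I))
      (+-nonneg (*-nonneg (fromℚ-mono (Q.*-nonneg 0≤g 0≤g)) 0≤I) (*-nonneg 0≤1+g 0≤εI-1))) λ n →
    solve 3 (λ g e i → i := con 1ℚ :+ g :+ ((con 1ℚ :+ g) :* ((con 1ℚ :- g :- e) :* i) :+
      (g :* g :* i :+ (con 1ℚ :+ g) :* (e :* i :- con 1ℚ)))) refl g (seq ε n) (seq I n)
    where 0≤1+g = fromℚ-mono (Q.+-nonneg (ℚₚ.<⇒≤ Q.0<1) 0≤g)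

module SizeConstant (s : ℕ) {g : ℚ} (0<g : 0ℚ ℚ.< g) where

  0<2+g : 0ℚ ℚ.< 2ℚ ℚ.+ g
  0<2+g = Q.+-pos (from-yes (0ℚ ℚₚ.<? 2ℚ)) 0<g

  -- `c = g / (2 + g)` is the value of `(x - 1) / (x + 1)` at `x = 1 + g`. It becomes a lower bound
  -- of `ln (1 / ε)` uniform in `ε ≤ 1 - g`.
  ρ D c : ℚ
  ρ = Q.recip (2ℚ ℚ.+ g) 0<2+g
  D = 2ℚ ℚ.* ρ
  c = 1ℚ ℚ.- D

  c≡gρ : c ≡ g ℚ.* ρ
  c≡gρ = trans (cong (ℚ._- D) (sym (Q.recip-invʳ (2ℚ ℚ.+ g) 0<2+g)))
    (solve 2 (λ g ρ → (con 2ℚ :+ g) :* ρ :- con 2ℚ :* ρ := g :* ρ) refl g ρ)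

  0<c : 0ℚ ℚ.< c
  0<c = subst (0ℚ ℚ.<_) (sym c≡gρ) (Q.*-pos 0<g (Q.recip-pos (2ℚ ℚ.+ g) 0<2+g))

  -- `κ` pays for the number of levels: 4 times the logarithm covers `m ∸ 6` of them, and
  -- `(7 + s) / c` times it the other `7 + s`. `T` comes from `2ˢ⁺ᵐ ≤ T * I`, as `I` is at least a
  -- quarter of `2ᵐ`.
  c⁻¹ κ T C : ℚ
  c⁻¹ = Q.recip c 0<c
  κ = 4ℚ ℚ.+ (7ℚ ℚ.+ Q.fromℕ s) ℚ.* c⁻¹
  T = 4ℚ ℚ.* Q.fromℕ (2 ℕ.^ s)
  C = T ℚ.* κ

  0≤7+s : 0ℚ ℚ.≤ 7ℚ ℚ.+ Q.fromℕ s
  0≤7+s = Q.+-nonneg (from-yes (0ℚ ℚₚ.≤? 7ℚ)) (Q.fromℕ-nonneg s)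

  0≤c⁻¹ : 0ℚ ℚ.≤ c⁻¹
  0≤c⁻¹ = ℚₚ.<⇒≤ (Q.recip-pos c 0<c)

  0<κ : 0ℚ ℚ.< κ
  0<κ = ℚₚ.<-≤-trans (from-yes (0ℚ ℚₚ.<? 4ℚ)) (cert-ℚ _ (Q.*-nonneg 0≤7+s 0≤c⁻¹) refl)

  0<T : 0ℚ ℚ.< T
  0<T = Q.*-pos (from-yes (0ℚ ℚₚ.<? 4ℚ)) (ℚₚ.<-≤-trans Q.0<1 (fromℕ-mono {1} (ℕₚ.m^n>0 2 s)))

  0<C : 0ℚ ℚ.< C
  0<C = Q.*-pos 0<T 0<κ

  module _ {ε : ℝ} (ε>0 : 0ℝ < ε) (ε≤1-g : ε ≤ fromℚ (1ℚ ℚ.- g)) {m : ℕ} (ε≤ : ε ≤ fromℚ (4ℚ ℚ.* dy m)) where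
    open Reciprocal ε ε>0

    L : ℝ
    L = ln I (inv>0 ε ε>0)

    2≤D[I+1] : fromℚ 2ℚ ≤ fromℚ D * (I + 1ℝ)
    2≤D[I+1] = ≤-cert (fromℚ D * (I - fromℚ (1ℚ ℚ.+ g)))
      (*-nonneg (fromℚ-mono (Q.*-nonneg (from-yes (0ℚ ℚₚ.≤? 2ℚ)) (ℚₚ.<⇒≤ (Q.recip-pos (2ℚ ℚ.+ g) 0<2+g))))
        (diff-nonneg (I-gap (ℚₚ.<⇒≤ 0<g) ε≤1-g))) λ n →
      trans (solve 3 (λ g ρ i → con 2ℚ :* ρ :* (i :+ con 1ℚ) :=
          con 2ℚ :* ((con 2ℚ :+ g) :* ρ) :+ con 2ℚ :* ρ :* (i :- (con 1ℚ :+ g))) refl g ρ (seq I n))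
        (cong (λ a → 2ℚ ℚ.* a ℚ.+ D ℚ.* (seq I n ℚ.- (1ℚ ℚ.+ g))) (Q.recip-invʳ (2ℚ ℚ.+ g) 0<2+g))

    c≤L : fromℚ c ≤ L
    c≤L = ln-lower-const I (inv>0 ε ε>0) 0<c 2≤D[I+1]

    log≤L : fromℚ (2ℚ ℚ.* (Q.fromℕ (m ℕ.∸ 6) ℚ.* dy 3)) ≤ L
    -- For `m ≤ 6` the truncated difference is 0, and `0 < c ≤ L` suffices.
    log≤L = Sum.[ small , large ]′ (ℕₚ.≤-total m 6)
      where
      small : m ℕ.≤ 6 → fromℚ (2ℚ ℚ.* (Q.fromℕ (m ℕ.∸ 6) ℚ.* dy 3)) ≤ L
      small m≤6 = ≤-trans (fromℚ-mono (ℚₚ.≤-trans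
        (ℚₚ.≤-reflexive (cong (λ j → 2ℚ ℚ.* (Q.fromℕ j ℚ.* dy 3)) (ℕₚ.m≤n⇒m∸n≡0 m≤6))) (ℚₚ.<⇒≤ 0<c))) c≤L
      large : 6 ℕ.≤ m → fromℚ (2ℚ ℚ.* (Q.fromℕ (m ℕ.∸ 6) ℚ.* dy 3)) ≤ L
      large 6≤m = ln-lower-log I (inv>0 ε ε>0) {m ℕ.∸ 6} (I-scale {m ℕ.∸ 6}
        (subst (λ k → ε ≤ fromℚ (4ℚ ℚ.* dy k)) (sym (ℕₚ.m+[n∸m]≡n 6≤m)) ε≤))

    -- `1 + s + m ≤ (7 + s) + (m ∸ 6)`, where `m ∸ 6 ≤ 4 * L` by `log≤L` and
    -- `7 + s ≤ (7 + s) * c⁻¹ * L` by `c≤L`.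
    levels≤κL : fromℚ (Q.fromℕ (suc (s ℕ.+ m))) ≤ fromℚ κ * L
    levels≤κL = ≤-cert
      (fromℚ 4ℚ * (L - fromℚ (2ℚ ℚ.* (Q.fromℕ j ℚ.* dy 3))) +
        (fromℚ (Q.fromℕ 6 ℚ.+ Q.fromℕ j ℚ.- Q.fromℕ m) + fromℚ (7ℚ ℚ.+ Q.fromℕ s) * (fromℚ c⁻¹ * (L - fromℚ c))))
      (+-nonneg (*-nonneg (fromℚ-mono (from-yes (0ℚ ℚₚ.≤? 4ℚ))) (diff-nonneg log≤L))
        (+-nonneg (fromℚ-mono (Q.diff-nonneg (subst (Q.fromℕ m ℚ.≤_) (fromℕ-+ 6 j) (fromℕ-mono (ℕₚ.m≤n+m∸n m 6)))))
          (*-nonneg (fromℚ-mono 0≤7+s) (*-nonneg (fromℚ-mono 0≤c⁻¹) (diff-nonneg c≤L))))) λ n →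
      trans (solve 6 (λ s m j k l c → (con 4ℚ :+ (con 7ℚ :+ s) :* k) :* l :=
          con 1ℚ :+ (s :+ m) :+ (con 4ℚ :* (l :- con 2ℚ :* (j :* con (dy 3))) :+
            (con (Q.fromℕ 6) :+ j :- m :+ (con 7ℚ :+ s) :* (k :* (l :- c)))) :+ (con 7ℚ :+ s) :* (c :* k :- con 1ℚ)) refl
          (Q.fromℕ s) (Q.fromℕ m) (Q.fromℕ j) c⁻¹ (seq L n) c)
        (trans (cong₂ (λ a b → 1ℚ ℚ.+ a ℚ.+ R n ℚ.+ (7ℚ ℚ.+ Q.fromℕ s) ℚ.* (b ℚ.- 1ℚ))
            (sym (fromℕ-+ s m)) (Q.recip-invʳ c 0<c))
          (solve 2 (λ a b → a :+ b :* (con 1ℚ :- con 1ℚ) := a) refl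
            (1ℚ ℚ.+ Q.fromℕ (s ℕ.+ m) ℚ.+ R n) (7ℚ ℚ.+ Q.fromℕ s)))
      where
      j : ℕ
      j = m ℕ.∸ 6
      R : ℕ → ℚ
      R n = 4ℚ ℚ.* (seq L n ℚ.- 2ℚ ℚ.* (Q.fromℕ j ℚ.* dy 3)) ℚ.+
        (Q.fromℕ 6 ℚ.+ Q.fromℕ j ℚ.- Q.fromℕ m ℚ.+ (7ℚ ℚ.+ Q.fromℕ s) ℚ.* (c⁻¹ ℚ.* (seq L n ℚ.- c)))

    size≤ : fromℕ (suc (s ℕ.+ m) ℕ.* 2 ℕ.^ (s ℕ.+ m)) ≤ fromℚ C * (I * L)
    size≤ = ≤-cert
      (fromℚ T * ((fromℚ κ * L) * (I - fromℚ (¼ ℚ.* P)) + fromℚ (¼ ℚ.* P) * (fromℚ κ * L - fromℚ N)))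
      (*-nonneg (fromℚ-mono (ℚₚ.<⇒≤ 0<T)) (+-nonneg
        (*-nonneg (*-nonneg (fromℚ-mono (ℚₚ.<⇒≤ 0<κ)) (≤-trans (fromℚ-mono (ℚₚ.<⇒≤ 0<c)) c≤L))
          (diff-nonneg (I-lower {m} ε≤)))
        (*-nonneg (fromℚ-mono (Q.*-nonneg (from-yes (0ℚ ℚₚ.≤? ¼)) (Q.fromℕ-nonneg (2 ℕ.^ m)))) (diff-nonneg levels≤κL)))) λ n →
      trans (solve 6 (λ t κ i l p N → con 4ℚ :* t :* κ :* (i :* l) := N :* (t :* p) :+
          con 4ℚ :* t :* ((κ :* l) :* (i :- con ¼ :* p) :+ con ¼ :* p :* (κ :* l :- N))) refl
          (Q.fromℕ (2 ℕ.^ s)) κ (seq I n) (seq L n) P N)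
        (cong (ℚ._+ T ℚ.* ((κ ℚ.* seq L n) ℚ.* (seq I n ℚ.- ¼ ℚ.* P) ℚ.+ ¼ ℚ.* P ℚ.* (κ ℚ.* seq L n ℚ.- N))) (sym size))
      where
      P N : ℚ
      P = Q.fromℕ (2 ℕ.^ m)
      N = Q.fromℕ (suc (s ℕ.+ m))
      size : ℤ.+ (suc (s ℕ.+ m) ℕ.* 2 ℕ.^ (s ℕ.+ m)) ℚ./ 1 ≡ N ℚ.* (Q.fromℕ (2 ℕ.^ s) ℚ.* P)
      size = trans (sym (Q.fromℕ-/ (suc (s ℕ.+ m) ℕ.* 2 ℕ.^ (s ℕ.+ m))))
        (trans (fromℕ-* (suc (s ℕ.+ m)) (2 ℕ.^ (s ℕ.+ m)))
          (cong (N ℚ.*_) (trans (cong Q.fromℕ (ℕₚ.^-distribˡ-+-* 2 s m)) (fromℕ-* (2 ℕ.^ s) (2 ℕ.^ m)))))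

-- `dyadic-scale-pos` requires `ε ≤ 4`; an `ε` found to be at least 3 gets level 0. The upper bound
-- serves the size estimate, where `ε < 1`.
choose-scale : ∀ {ε} → 0ℝ < ε → ∃[ m ] fromℚ (dy m) ≤ ε × (ε ≤ 1ℝ → ε ≤ fromℚ (4ℚ ℚ.* dy m))
choose-scale {ε} ε>0 = Sum.[ large , small ]′ (approx-split (from-yes ((2ℚ ℚ.+ 1ℚ) ℚₚ.<? 4ℚ)) ε)
  where
  large : fromℚ (2ℚ ℚ.+ 1ℚ) ≤ ε → ∃[ m ] fromℚ (dy m) ≤ ε × (ε ≤ 1ℝ → ε ≤ fromℚ (4ℚ ℚ.* dy m))
  large 3≤ε = 0 , ≤-trans (fromℚ-mono (from-yes (1ℚ ℚₚ.≤? (2ℚ ℚ.+ 1ℚ)))) 3≤ε ,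
    λ ε≤1 → ≤-trans ε≤1 (fromℚ-mono (from-yes (1ℚ ℚₚ.≤? (4ℚ ℚ.* 1ℚ))))
  small : ε ≤ fromℚ 4ℚ → ∃[ m ] fromℚ (dy m) ≤ ε × (ε ≤ 1ℝ → ε ≤ fromℚ (4ℚ ℚ.* dy m))
  small ε≤4 = let (m , ≤ε , ε≤) = dyadic-scale-pos ε>0 ε≤4 in m , ≤ε , λ _ → ε≤

-- `C` depends on `ε₀` through its gap to 1, because `ln (1 / ε)` tends to 0 as `ε` tends to 1 while
-- the net stays nonempty.
length-bound : ∀ s ε₀ → ε₀ < 1ℝ → ∃[ C ] 0ℝ < C × ((ε : ℝ) (ε>0 : 0ℝ < ε) → ε ≤ ε₀ →
  fromℕ (length (net (s ℕ.+ proj₁ (choose-scale ε>0)))) ≤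
    C * (inv ε ε>0 * ln (inv ε ε>0) (inv>0 ε ε>0)))
length-bound s ε₀ ε₀<1 = fromℚ C , fromℚ≤⇒pos 0<C ≤-refl , λ ε ε>0 ε≤ε₀ →
  let (m , _ , ε≤) = choose-scale ε>0
  in subst (λ k → fromℕ k ≤ fromℚ C * (inv ε ε>0 * ln (inv ε ε>0) (inv>0 ε ε>0)))
       (sym (length-net (s ℕ.+ m)))
       (size≤ {ε} ε>0 (≤-trans ε≤ε₀ ε₀≤1-g) {m} (ε≤ (≤-trans ε≤ε₀ (<⇒≤ ε₀<1))))
  where
  g = gap ε₀<1
  open SizeConstant s (gap>0 ε₀<1)
  ε₀≤1-g : ε₀ ≤ fromℚ (1ℚ ℚ.- g)
  ε₀≤1-g = ≤-eventual (ev-map (λ n h → cert-ℚ (1ℚ ℚ.- (seq ε₀ n ℚ.+ g)) (Q.diff-nonneg h)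
    (solve 2 (λ e g → con 1ℚ :- g := e :+ (con 1ℚ :- (e :+ g))) refl (seq ε₀ n) g)) (separated ε₀<1))

corollary1p0p2 : Σ[ N ∈ ((ε : ℝ) → 0ℝ < ε → List ℝ²) ]
    ((ε : ℝ) (ε>0 : 0ℝ < ε) → IsNet boxSpace ε (N ε ε>0)) ×
    ((ε₀ : ℝ) → ε₀ < 1ℝ →
    ∃[ C ] 0ℝ < C ×
    ((ε : ℝ) (ε>0 : 0ℝ < ε) → ε ≤ ε₀ →
    fromℕ (length (N ε ε>0)) ≤ C * (inv ε ε>0 * ln (inv ε ε>0) (inv>0 ε ε>0))))
corollary1p0p2 = (λ ε ε>0 → net (18 ℕ.+ proj₁ (choose-scale ε>0))) , isNet , length-bound 18
  where
  isNet : (ε : ℝ) (ε>0 : 0ℝ < ε) → IsNet boxSpace ε (net (18 ℕ.+ proj₁ (choose-scale ε>0)))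
  isNet ε ε>0 = net-⊆ (18 ℕ.+ proj₁ (choose-scale ε>0)) , λ R (isBox , R⊆) ε≤R →
    let (m , dym≤ε , _) = choose-scale ε>0
        (p , q , pt , r) = net-hits {m = m} dym≤ε isBox R⊆ ε≤R
    in lose (∈-net pt) r
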